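{- Let $\mathcal{M}$ be a nondeterministic Turing machine with finite state set $Q$, and let $S_{\mathcal{M}}\subseteq Q^{\mathbb{N}}$ be the set of sequences $(s_t)_{t\in\mathbb{N}}$ such that there exists a non-terminating run of $\mathcal{M}$ on the empty input whose state at time $t$ is $s_t$ for all $t$. Then the Toeplitzification $T_{\mathcal{M}}:=T_{S_{\mathcal{M}}}$ is an effective $\mathbb{Z}$ subshift.
   Context: Consider the substitution $\sigma$ on the alphabet $\{a,\bar a,b,\bar b\}$ given by $\sigma(\bar a)=a\bar b$, $\sigma(\bar b)=b\bar b$, $\sigma(a)=a\bar a$, $\sigma(b)=b\bar a$, and let $X_\sigma\subseteq\{a,\bar a,b,\bar b\}^{\mathbb{Z}}$ be the subshift whose forbidden patterns are all finite words not appearing in the infinite word $\sigma^\omega(a)=\lim_n\sigma^n(a)$. The binary Toeplitz subshift $X_T\subseteq\{a,b\}^{\mathbb{Z}}$ is the image of $X_\sigma$ under the cellwise projection $a,\bar a\mapsto a$ and $b,\bar b\mapsto b$. For $z\in X_T$ and $i\in\mathbb{Z}$, $\mathrm{level}_z(i)=\ell\in\mathbb{N}$ if $2^{\ell+1}$ is the minimal $2^{m}$ such that $z_{i+k2^{m}}=z_i$ for all $k\in\mathbb{Z}$ (i.e. the position has minimal period $2^{\ell+1}$ of this form), and $\mathrm{level}_z(i)=\infty$ if no such period exists. For a set $A\subseteq\Sigma^{\mathbb{N}}$, its Toeplitzification is $T_A=\{(x,z)\in(\Sigma\times\{a,b\})^{\mathbb{Z}} : z\in X_T,\ \exists (a_n)_{n\in\mathbb{N}}\in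 A,\ \forall i\in\mathbb{Z},\ \mathrm{level}_z(i)=\ell\in\mathbb{N}\Rightarrow x_i=a_\ell\}$. A $\mathbb{Z}$ subshift is effective if it is the set of all bi-infinite sequences avoiding some recursively enumerable family of finite forbidden patterns. -}

module Defs where

open import Level using (0ℓ)
open import Data.Nat using (ℕ; zero; suc; _^_; _<_)
open import Data.Integer using (ℤ; +_; -[1+_]; _+_; _*_)
open import Data.Fin using (Fin) renaming (zero to fzero)
open import Data.List.Membership.Propositional using (_∈_)
open import Data.Product using (proj₁; proj₂)
open import Data.List using (length)
open import Data.List using (List; []; _∷_; _++_; map; concatMap; upTo)
open import Data.Maybe using (Maybe; just)
open import Data.Product using (Σ; ∃; _×_; _,_)
open import Data.Sum using (_⊎_)
open import Relation.Nullary using (¬_)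
open import Relation.Binary.PropositionalEquality using (_≡_; _≢_)
open import Function.Bundles using (_⇔_)
open import Axiom.ExcludedMiddle using (ExcludedMiddle)

-- Nondeterministic Turing machines (bi-infinite tape indexed by ℤ)
-- states Fin n, tape alphabet Fin (suc m) with blank symbol = zero.

data Move : Set where
  L R : Move

moveBy : Move → ℤ
moveBy L = -[1+ 0 ]
moveBy R = + 1

record NTM (n m : ℕ) : Set where
  field
    start : Fin n
    δ     : Fin n → Fin (suc m) → List (Fin n × Fin (suc m) × Move)

record Config (n m : ℕ) : Set where
  field
    state : Fin n
    head  : ℤ
    tape  : ℤ → Fin (suc m)

open Config public

Step : ∀ {n m} → NTM n m → Config n m → Config n m → Set
Step {n} {m} M c c' =
  Σ (Fin n × Fin (suc m) × Move) λ { (q' , γ' , d) →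
      (q' , γ' , d) ∈ NTM.δ M (state c) (tape c (head c))
    × state c' ≡ q'
    × head c' ≡ head c + moveBy d
    × tape c' (head c) ≡ γ'
    × (∀ i → i ≢ head c → tape c' i ≡ tape c i) }

Run : ∀ {n m} → NTM n m → (ℕ → Config n m) → Set
Run {n} {m} M r =
    (state (r 0) ≡ NTM.start M × head (r 0) ≡ + 0 × (∀ i → tape (r 0) i ≡ fzero))
  × (∀ t → Step M (r t) (r (suc t)))

S : ∀ {n m} → NTM n m → (ℕ → Fin n) → Set
S M s = ∃ λ r → Run M r × (∀ t → state (r t) ≡ s t)

data L4 : Set where
  a ā b b̄ : L4

σ : L4 → List L4
σ ā = a ∷ b̄ ∷ []
σ b̄ = b ∷ b̄ ∷ []
σ a = a ∷ ā ∷ []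
σ b = b ∷ ā ∷ []

σ^ : ℕ → List L4
σ^ zero = a ∷ []
σ^ (suc k) = concatMap σ (σ^ k)

-- w appears in σ^ω(a) (σ^k(a) is a prefix of σ^ω(a) for every k)
AppearsInσω : List L4 → Set
AppearsInσω w = ∃ λ k → ∃ λ u → ∃ λ v → σ^ k ≡ u ++ (w ++ v)

window : {A : Set} → (ℤ → A) → ℤ → ℕ → List A
window y i len = map (λ j → y (i + + j)) (upTo len)

Xσ : (ℤ → L4) → Set
Xσ y = ∀ i len → AppearsInσω (window y i len)

data AB : Set where
  a b : AB

proj : L4 → AB
proj a = a
proj ā = a
proj b = b
proj b̄ = b

XT : (ℤ → AB) → Set
XT z = ∃ λ y → Xσ y × (∀ i → z i ≡ proj (y i))

HasPeriod : (ℤ → AB) → ℤ → ℕ → Set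
HasPeriod z i m = ∀ (k : ℤ) → z (i + k * + (2 ^ m)) ≡ z i

Level : (ℤ → AB) → ℤ → ℕ → Set
Level z i ℓ = HasPeriod z i (suc ℓ) × (∀ m → m < suc ℓ → ¬ HasPeriod z i m)

Toeplitzification : {Σ₀ : Set} → ((ℕ → Σ₀) → Set) → (ℤ → Σ₀ × AB) → Set
Toeplitzification {Σ₀} A c =
    XT (λ i → proj₂ (c i))
  × ∃ λ (α : ℕ → Σ₀) → A α
      × (∀ i ℓ → Level (λ j → proj₂ (c j)) i ℓ → proj₁ (c i) ≡ α ℓ)

-- A recursively enumerable family of forbidden words is given by an Agda
-- function ℕ → Maybe (List A) (definable functions in --safe Agda are
-- computable; `nothing` entries allow finite/empty families).

OccursAt : {A : Set} → List A → (ℤ → A) → ℤ → Set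
OccursAt w c i = window c i (length w) ≡ w

Avoids : {A : Set} → (ℕ → Maybe (List A)) → (ℤ → A) → Set
Avoids F c = ∀ k w → F k ≡ just w → ∀ i → ¬ OccursAt w c i

-- The set
-- equality is asserted classically (under excluded middle), which is only
-- available after F has been chosen, so F itself must be constructive.
Effective : {A : Set} → ((ℤ → A) → Set) → Set₁
Effective {A} X =
  Σ (ℕ → Maybe (List A)) λ F →
    ExcludedMiddle 0ℓ → ∀ (c : ℤ → A) → (X c ⇔ Avoids F c)

-- A point (x , z) of T_M is governed by z ∈ X_T, and the points of X_T are exactly the
-- Toeplitz words with a 2-adic phase W: z i = a when W + i ≡ 2^v (mod 2^(v+2)) and
-- z i = b when W + i ≡ 3·2^v (mod 2^(v+2)); the level of i is then one more than the
-- 2-adic valuation of W + i.  So a finite word w is a window of T_M exactly when some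
-- residue of the phase modulo 2^|w| and some |w| steps of the machine explain all its
-- letters.  This is decidable, and the words failing it are the computably enumerated
-- forbidden words.  Conversely, if every window of c is explained, König's lemma glues
-- the explanations of the centred windows, which form a finitely branching tree, into
-- one phase and one infinite run, so that c ∈ T_M.

module Submission where

open import Defs
open import Level using (0ℓ)
open import Axiom.ExcludedMiddle using (ExcludedMiddle)
open import Axiom.DoubleNegationElimination using (em⇒dne)
open import Data.Nat as ℕ using (ℕ; zero; suc; _^_; _<_; _≤_; z≤n; s≤s; NonZero; ⌊_/2⌋; parity)
import Data.Nat.Properties as ℕP
open ℕP using (anyUpTo?; allUpTo?)
open import Data.Nat.DivMod
  using (_%_; _/_; m%n<n; m≡m%n+[m/n]*n; [m+kn]%n≡m%n; m<n⇒m%n≡m; +-distrib-/; m*n%n≡0; m<n⇒m/n≡0; m*n/n≡m)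
open import Data.Nat.Tactic.RingSolver as ℕ-Solver using ()
open import Data.Integer using (ℤ; +_; -[1+_]; _+_; _*_; -_)
import Data.Integer.Properties as ℤP
open import Data.Integer.DivMod using (_%ℕ_; _/ℕ_; a≡a%ℕn+[a/ℕn]*n; n%ℕd<d)
open import Data.Integer.Tactic.RingSolver using (solve-∀)
open import Data.Parity as ℙ using (Parity; 0ℙ; 1ℙ)
import Data.Parity.Properties as ℙP
open import Data.Fin as Fin using (Fin; toℕ; fromℕ<) renaming (zero to fzero)
import Data.Fin.Properties as FinP
open import Data.Vec using (Vec; []; _∷_)
open import Data.List
  using (List; []; _∷_; _++_; _∷ʳ_; length; concatMap; upTo; applyUpTo; take; drop; allFin; cartesianProductWith)
import Data.List.Properties as LP
open import Data.List.Extrema.Nat using (max; xs≤max)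
open import Data.List.Membership.Propositional using (_∈_)
open import Data.List.Membership.Propositional.Properties using (∈-cartesianProductWith⁺; ∈-allFin)
open import Data.List.Relation.Unary.All as All using (All; []; _∷_)
import Data.List.Relation.Unary.All.Properties as AllP
open import Data.List.Relation.Unary.Any using (here; there)
open import Data.Maybe as Maybe using (Maybe; just; nothing; Is-just; fromMaybe)
import Data.Maybe.Properties as MaybeP
import Data.Maybe.Relation.Unary.All as MaybeAll
import Data.Maybe.Relation.Unary.Any as MaybeAny
open import Data.Product using (Σ; ∃; _×_; _,_; proj₁; proj₂)
open import Data.Sum using (_⊎_; inj₁; inj₂; [_,_]′)
open import Data.Unit using (tt)
open import Data.Empty using (⊥-elim)
open import Function.Bundles using (mk⇔)
open import Relation.Nullary using (Dec; yes; no; ¬_)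
open import Relation.Nullary.Decidable using (_×-dec_; _→-dec_)
open import Relation.Binary using (tri<; tri≈; tri>)
open import Relation.Binary.PropositionalEquality

-- Congruences modulo powers of two

pow2 : ℕ → ℤ
pow2 e = + (2 ^ e)

2^-nonZero : ∀ e → NonZero (2 ^ e)
2^-nonZero e = ℕP.m^n≢0 2 e

record _≡_[mod2^_] (x y : ℤ) (e : ℕ) : Set where
  constructor witness
  field
    quotient : ℤ
    equation : x ≡ y + quotient * pow2 e

infix 4 _≡_[mod2^_]

negate-quotient : ∀ {x y} k c → x ≡ y + k * c → y ≡ x + (- k) * c
negate-quotient {y = y} k c refl = y≡y+kc-kc y k c
  where y≡y+kc-kc : ∀ y k c → y ≡ (y + k * c) + (- k) * c
        y≡y+kc-kc = solve-∀

module _ {e : ℕ} where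

  mod-refl : ∀ {x} → x ≡ x [mod2^ e ]
  mod-refl {x} = witness (+ 0) (sym (ℤP.+-identityʳ x))

  mod-sym : ∀ {x y} → x ≡ y [mod2^ e ] → y ≡ x [mod2^ e ]
  mod-sym (witness k eq) = witness (- k) (negate-quotient k (pow2 e) eq)

  mod-trans : ∀ {x y z} → x ≡ y [mod2^ e ] → y ≡ z [mod2^ e ] → x ≡ z [mod2^ e ]
  mod-trans {z = z} (witness k refl) (witness l refl) = witness (l + k) (z+lc+kc≡z+[l+k]c z k l (pow2 e))
    where z+lc+kc≡z+[l+k]c : ∀ z k l c → (z + l * c) + k * c ≡ z + (l + k) * c
          z+lc+kc≡z+[l+k]c = solve-∀

  mod-+ʳ : ∀ {x y} z → x ≡ y [mod2^ e ] → x + z ≡ y + z [mod2^ e ]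
  mod-+ʳ {y = y} z (witness k refl) = witness k (y+kc+z≡y+z+kc y z k (pow2 e))
    where y+kc+z≡y+z+kc : ∀ y z k c → (y + k * c) + z ≡ (y + z) + k * c
          y+kc+z≡y+z+kc = solve-∀

  +-multiple : ∀ x k → x + k * pow2 e ≡ x [mod2^ e ]
  +-multiple x k = witness k refl

pow2-+ : ∀ f e → pow2 (f ℕ.+ e) ≡ pow2 f * pow2 e
pow2-+ f e = trans (cong +_ (ℕP.^-distribˡ-+-* 2 f e)) (ℤP.pos-* (2 ^ f) (2 ^ e))

mod-weaken : ∀ {e e′ x y} → e ≤ e′ → x ≡ y [mod2^ e′ ] → x ≡ y [mod2^ e ]
mod-weaken {e} {e′} {x} {y} e≤e′ (witness k eq) = witness (k * pow2 (e′ ℕ.∸ e)) (begin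
  x                                   ≡⟨ eq ⟩
  y + k * pow2 e′                     ≡⟨ cong (λ f → y + k * pow2 f) (sym (ℕP.m∸n+n≡m e≤e′)) ⟩
  y + k * pow2 (e′ ℕ.∸ e ℕ.+ e)       ≡⟨ cong (λ p → y + k * p) (pow2-+ (e′ ℕ.∸ e) e) ⟩
  y + k * (pow2 (e′ ℕ.∸ e) * pow2 e)  ≡⟨ cong (λ t → y + t) (sym (ℤP.*-assoc k _ _)) ⟩
  y + k * pow2 (e′ ℕ.∸ e) * pow2 e    ∎)
  where open ≡-Reasoning

residue : ∀ e x → ∃ λ c → c < 2 ^ e × x ≡ + c [mod2^ e ]
residue e x = _%ℕ_ x (2 ^ e) {{2^-nonZero e}} , n%ℕd<d x (2 ^ e) {{2^-nonZero e}} ,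
  witness (_/ℕ_ x (2 ^ e) {{2^-nonZero e}}) (a≡a%ℕn+[a/ℕn]*n x (2 ^ e) {{2^-nonZero e}})

private
  no-positive-multiple : ∀ {e c₁ c₂ n} → c₁ < 2 ^ e → ¬ (+ c₁ ≡ + c₂ + + suc n * pow2 e)
  no-positive-multiple {e} {c₁} {c₂} {n} c₁<2^e eq = ℕP.<⇒≱ c₁<2^e (begin
    2 ^ e                           ≤⟨ ℕP.m≤m+n (2 ^ e) (n ℕ.* 2 ^ e) ⟩
    suc n ℕ.* 2 ^ e                 ≤⟨ ℕP.m≤n+m _ c₂ ⟩
    c₂ ℕ.+ suc n ℕ.* 2 ^ e          ≡⟨ ℤP.+-injective (sym (trans eq (cong (λ t → + c₂ + t)
                                                                   (sym (ℤP.pos-* (suc n) (2 ^ e)))))) ⟩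
    c₁                              ∎)
    where open ℕP.≤-Reasoning

residue-unique : ∀ {e c₁ c₂} → c₁ < 2 ^ e → c₂ < 2 ^ e → + c₁ ≡ + c₂ [mod2^ e ] → c₁ ≡ c₂
residue-unique {c₂ = c₂} _ _ (witness (+ zero) eq) = ℤP.+-injective (trans eq (ℤP.+-identityʳ (+ c₂)))
residue-unique {e} c₁< _ (witness (+ suc n) eq) = ⊥-elim (no-positive-multiple {e} {n = n} c₁< eq)
residue-unique {e} _ c₂< (witness -[1+ n ] eq) =
  ⊥-elim (no-positive-multiple {e} {n = n} c₂< (negate-quotient -[1+ n ] (pow2 e) eq))

residue-split : ∀ {e x c} → c < 2 ^ e → x ≡ + c [mod2^ e ] →
                x ≡ + c [mod2^ suc e ] ⊎ x ≡ + (c ℕ.+ 2 ^ e) [mod2^ suc e ]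
residue-split {e} {x} {c} c<2^e x≡c with residue (suc e) x
... | c′ , c′<2^1+e , x≡c′ with c′ ℕ.<? 2 ^ e
...   | yes c′<2^e = inj₁ (subst (λ r → x ≡ + r [mod2^ suc e ]) (sym c≡c′) x≡c′)
  where c≡c′ : c ≡ c′
        c≡c′ = residue-unique c<2^e c′<2^e (mod-trans (mod-sym x≡c) (mod-weaken (ℕP.n≤1+n e) x≡c′))
...   | no c′≮2^e = inj₂ (subst (λ r → x ≡ + r [mod2^ suc e ]) c′≡c+2^e x≡c′)
  where
    d = c′ ℕ.∸ 2 ^ e
    d+2^e≡c′ : d ℕ.+ 2 ^ e ≡ c′
    d+2^e≡c′ = ℕP.m∸n+n≡m (ℕP.≮⇒≥ c′≮2^e)
    d<2^e : d < 2 ^ e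
    d<2^e = ℕP.+-cancelʳ-< (2 ^ e) d (2 ^ e)
              (subst₂ _<_ (sym d+2^e≡c′) (cong (2 ^ e ℕ.+_) (ℕP.+-identityʳ (2 ^ e))) c′<2^1+e)
    c′≡d : + c′ ≡ + d [mod2^ e ]
    c′≡d = witness (+ 1) (trans (cong +_ (sym d+2^e≡c′)) (trans (ℤP.pos-+ d (2 ^ e))
             (cong (λ p → + d + p) (sym (ℤP.*-identityˡ (pow2 e))))))
    c≡d : c ≡ d
    c≡d = residue-unique c<2^e d<2^e
            (mod-trans (mod-sym x≡c) (mod-trans (mod-weaken (ℕP.n≤1+n e) x≡c′) c′≡d))
    c′≡c+2^e : c′ ≡ c ℕ.+ 2 ^ e
    c′≡c+2^e = trans (sym d+2^e≡c′) (cong (ℕ._+ 2 ^ e) (sym c≡d))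

HasValuation : ℤ → ℕ → Set
HasValuation x w = x ≡ pow2 w [mod2^ suc w ]

divisible⊎valuation< : ∀ e x → x ≡ + 0 [mod2^ e ] ⊎ ∃ λ w → w < e × HasValuation x w
divisible⊎valuation< zero x = inj₁ (witness x (sym (trans (ℤP.+-identityˡ _) (ℤP.*-identityʳ x))))
divisible⊎valuation< (suc e) x with divisible⊎valuation< e x
... | inj₂ (w , w<e , val) = inj₂ (w , ℕP.m≤n⇒m≤1+n w<e , val)
... | inj₁ x≡0 with residue-split (ℕP.m^n>0 2 e) x≡0
...   | inj₁ x≡0′ = inj₁ x≡0′
...   | inj₂ x≡2^e = inj₂ (e , ℕP.n<1+n e , x≡2^e)

_%2^_ : ℕ → ℕ → ℕ
u %2^ e = _%_ u (2 ^ e) {{2^-nonZero e}}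

%2^-< : ∀ u e → u %2^ e < 2 ^ e
%2^-< u e = m%n<n u (2 ^ e) {{2^-nonZero e}}

≡%2^ : ∀ u e → + u ≡ + (u %2^ e) [mod2^ e ]
≡%2^ u e = witness (+ q) (begin
  + u                                ≡⟨ cong +_ (m≡m%n+[m/n]*n u (2 ^ e) {{2^-nonZero e}}) ⟩
  + (u %2^ e ℕ.+ q ℕ.* 2 ^ e)        ≡⟨ ℤP.pos-+ (u %2^ e) _ ⟩
  + (u %2^ e) + + (q ℕ.* 2 ^ e)      ≡⟨ cong (λ p → + (u %2^ e) + p) (ℤP.pos-* q (2 ^ e)) ⟩
  + (u %2^ e) + + q * pow2 e         ∎)
  where open ≡-Reasoning
        q = _/_ u (2 ^ e) {{2^-nonZero e}}

%2^≡⇒≡[mod2^] : ∀ {u e c} → u %2^ e ≡ c → + u ≡ + c [mod2^ e ]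
%2^≡⇒≡[mod2^] {u} {e} refl = ≡%2^ u e

≡[mod2^]⇒%2^≡ : ∀ {u e c} → + u ≡ + c [mod2^ e ] → c < 2 ^ e → u %2^ e ≡ c
≡[mod2^]⇒%2^≡ {u} {e} u≡c c< = residue-unique (%2^-< u e) c< (mod-trans (mod-sym (≡%2^ u e)) u≡c)

≡[mod2^]⇒∃quotient : ∀ {e j c} → + j ≡ + c [mod2^ e ] → c < 2 ^ e → ∃ λ q → j ≡ c ℕ.+ q ℕ.* 2 ^ e
≡[mod2^]⇒∃quotient {e} {j} {c} (witness (+ q) eq) _ =
  q , ℤP.+-injective (trans eq (trans (cong (λ p → + c + p) (sym (ℤP.pos-* q (2 ^ e)))) (sym (ℤP.pos-+ c _))))
≡[mod2^]⇒∃quotient {e} (witness -[1+ n ] eq) c< =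
  ⊥-elim (no-positive-multiple {e} {n = n} c< (negate-quotient -[1+ n ] (pow2 e) eq))

mod-+-cancelʳ : ∀ {e} x y t → + (x ℕ.+ t) ≡ + (y ℕ.+ t) [mod2^ e ] → + x ≡ + y [mod2^ e ]
mod-+-cancelʳ x y t x+t≡y+t =
  subst₂ (_≡_[mod2^ _ ]) (drop-t x) (drop-t y) (mod-+ʳ (- + t) x+t≡y+t)
  where drop-t : ∀ u → + (u ℕ.+ t) + - + t ≡ + u
        drop-t u = trans (cong (_+ - + t) (ℤP.pos-+ u t)) (u+t-t≡u (+ u) (+ t))
          where u+t-t≡u : ∀ u t → (u + t) + - t ≡ u
                u+t-t≡u = solve-∀

mod-+-cancelˡ : ∀ {e} t x y → + (t ℕ.+ x) ≡ + (t ℕ.+ y) [mod2^ e ] → + x ≡ + y [mod2^ e ]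
mod-+-cancelˡ {e} t x y t+x≡t+y =
  mod-+-cancelʳ x y t (subst₂ (λ p q → + p ≡ + q [mod2^ e ]) (ℕP.+-comm t x) (ℕP.+-comm t y) t+x≡t+y)

nth : {A : Set} → List A → ℕ → Maybe A
nth []       _       = nothing
nth (x ∷ xs) zero    = just x
nth (x ∷ xs) (suc t) = nth xs t

module _ {A : Set} where

  nth-++ʳ : ∀ (u r : List A) t → nth (u ++ r) (length u ℕ.+ t) ≡ nth r t
  nth-++ʳ []      r t = refl
  nth-++ʳ (x ∷ u) r t = nth-++ʳ u r t

  nth-++ˡ : ∀ (w v : List A) {t} → t < length w → nth (w ++ v) t ≡ nth w t
  nth-++ˡ (x ∷ w) v {zero}  _         = refl
  nth-++ˡ (x ∷ w) v {suc t} (s≤s t<) = nth-++ˡ w v t<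

  nth⇒∈ : ∀ (l : List A) k {x} → nth l k ≡ just x → x ∈ l
  nth⇒∈ (y ∷ l) zero    refl = here refl
  nth⇒∈ (y ∷ l) (suc k) eq   = there (nth⇒∈ l k eq)

  ∈⇒nth : ∀ {l : List A} {x} → x ∈ l → ∃ λ k → nth l k ≡ just x
  ∈⇒nth (here refl) = 0 , refl
  ∈⇒nth (there x∈l) = let k , eq = ∈⇒nth x∈l in suc k , eq

  nth⇒< : ∀ (l : List A) k {x} → nth l k ≡ just x → k < length l
  nth⇒< (y ∷ l) zero    _  = s≤s z≤n
  nth⇒< (y ∷ l) (suc k) eq = s≤s (nth⇒< l k eq)

  prefix-at : ∀ (l w : List A) → (∀ t → t < length w → nth l t ≡ nth w t) → l ≡ w ++ drop (length w) l
  prefix-at l       []      _ = refl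
  prefix-at []      (x ∷ w) h with h 0 (s≤s z≤n)
  ... | ()
  prefix-at (y ∷ l) (x ∷ w) h with h 0 (s≤s z≤n)
  ... | refl = cong (x ∷_) (prefix-at l w (λ t t< → h (suc t) (s≤s t<)))

  infix-at : ∀ (l : List A) J (w : List A) → (∀ t → t < length w → nth l (J ℕ.+ t) ≡ nth w t) →
             l ≡ take J l ++ (w ++ drop (J ℕ.+ length w) l)
  infix-at l       zero    w       h = prefix-at l w h
  infix-at []      (suc J) []      _ = refl
  infix-at []      (suc J) (x ∷ w) h with h 0 (s≤s z≤n)
  ... | ()
  infix-at (y ∷ l) (suc J) w       h = cong (y ∷_) (infix-at l J w h)

  nth-applyUpTo : ∀ (f : ℕ → A) n {t} → t < n → nth (applyUpTo f n) t ≡ just (f t)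
  nth-applyUpTo f (suc n) {zero}  _        = refl
  nth-applyUpTo f (suc n) {suc t} (s≤s t<) = nth-applyUpTo (λ k → f (suc k)) n t<

  length-window : ∀ (c : ℤ → A) i n → length (window c i n) ≡ n
  length-window c i n = trans (LP.length-map _ (upTo n)) (LP.length-upTo n)

  nth-window : ∀ (c : ℤ → A) i n {t} → t < n → nth (window c i n) t ≡ just (c (i + + t))
  nth-window c i n t< = trans (cong (λ l → nth l _) (LP.map-upTo _ n)) (nth-applyUpTo _ n t<)

-- The fixed point σ^ω(a)

σ-at : L4 → Parity → L4
σ-at a  0ℙ = a
σ-at ā  0ℙ = a
σ-at b  0ℙ = b
σ-at b̄  0ℙ = b
σ-at a  1ℙ = ā
σ-at b  1ℙ = ā
σ-at ā  1ℙ = b̄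
σ-at b̄  1ℙ = b̄

σ≡σ-at : ∀ x → σ x ≡ σ-at x 0ℙ ∷ σ-at x 1ℙ ∷ []
σ≡σ-at a = refl
σ≡σ-at ā = refl
σ≡σ-at b = refl
σ≡σ-at b̄ = refl

barParity : L4 → Parity
barParity a = 0ℙ
barParity b = 0ℙ
barParity ā = 1ℙ
barParity b̄ = 1ℙ

toL4 : AB → Parity → L4
toL4 a 0ℙ = a
toL4 a 1ℙ = ā
toL4 b 0ℙ = b
toL4 b 1ℙ = b̄

proj-toL4 : ∀ s p → proj (toL4 s p) ≡ s
proj-toL4 a 0ℙ = refl
proj-toL4 a 1ℙ = refl
proj-toL4 b 0ℙ = refl
proj-toL4 b 1ℙ = refl

barParity-toL4 : ∀ s p → barParity (toL4 s p) ≡ p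
barParity-toL4 a 0ℙ = refl
barParity-toL4 a 1ℙ = refl
barParity-toL4 b 0ℙ = refl
barParity-toL4 b 1ℙ = refl

toL4-proj-barParity : ∀ x → toL4 (proj x) (barParity x) ≡ x
toL4-proj-barParity a = refl
toL4-proj-barParity ā = refl
toL4-proj-barParity b = refl
toL4-proj-barParity b̄ = refl

L4-ext : ∀ {x y} → proj x ≡ proj y → barParity x ≡ barParity y → x ≡ y
L4-ext {x} {y} p≡ b≡ = trans (sym (toL4-proj-barParity x)) (trans (cong₂ toL4 p≡ b≡) (toL4-proj-barParity y))

barParity-σ-at : ∀ x p → barParity (σ-at x p) ≡ p
barParity-σ-at a 0ℙ = refl
barParity-σ-at ā 0ℙ = refl
barParity-σ-at b 0ℙ = refl
barParity-σ-at b̄ 0ℙ = refl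
barParity-σ-at a 1ℙ = refl
barParity-σ-at ā 1ℙ = refl
barParity-σ-at b 1ℙ = refl
barParity-σ-at b̄ 1ℙ = refl

proj-σ-at-0ℙ : ∀ x → proj (σ-at x 0ℙ) ≡ proj x
proj-σ-at-0ℙ a = refl
proj-σ-at-0ℙ ā = refl
proj-σ-at-0ℙ b = refl
proj-σ-at-0ℙ b̄ = refl

proj-σ-at-1ℙ-unbarred : ∀ x → barParity x ≡ 0ℙ → proj (σ-at x 1ℙ) ≡ a
proj-σ-at-1ℙ-unbarred a _ = refl
proj-σ-at-1ℙ-unbarred b _ = refl

proj-σ-at-1ℙ-barred : ∀ x → barParity x ≡ 1ℙ → proj (σ-at x 1ℙ) ≡ b
proj-σ-at-1ℙ-barred ā _ = refl
proj-σ-at-1ℙ-barred b̄ _ = refl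

letter : ℕ → ℕ → L4
letter zero    j = a
letter (suc k) j = σ-at (letter k ⌊ j /2⌋) (parity j)

nth-concatMap-σ : ∀ l j → nth (concatMap σ l) j ≡ Maybe.map (λ x → σ-at x (parity j)) (nth l ⌊ j /2⌋)
nth-concatMap-σ []      j                   = refl
nth-concatMap-σ (x ∷ l) j rewrite σ≡σ-at x with j
... | zero        = refl
... | suc zero    = refl
... | suc (suc j) = nth-concatMap-σ l j

length-σ^ : ∀ k → length (σ^ k) ≡ 2 ^ k
length-σ^ zero    = refl
length-σ^ (suc k) = trans (length-concatMap-σ (σ^ k)) (cong (2 ℕ.*_) (length-σ^ k))
  where
    length-concatMap-σ : ∀ l → length (concatMap σ l) ≡ 2 ℕ.* length l
    length-concatMap-σ []      = refl
    length-concatMap-σ (x ∷ l) rewrite σ≡σ-at x | length-concatMap-σ l = sym (ℕP.*-suc 2 (length l))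

⌊/2⌋-< : ∀ {j m} → j < 2 ℕ.* m → ⌊ j /2⌋ < m
⌊/2⌋-< {j} {m} j<2m = ℕP.*-cancelˡ-< 2 _ _ (ℕP.≤-<-trans (2⌊j/2⌋≤j j) j<2m)
  where
    2⌊j/2⌋≤j : ∀ j → 2 ℕ.* ⌊ j /2⌋ ≤ j
    2⌊j/2⌋≤j zero          = z≤n
    2⌊j/2⌋≤j (suc zero)    = z≤n
    2⌊j/2⌋≤j (suc (suc j)) rewrite ℕP.*-suc 2 ⌊ j /2⌋ = s≤s (s≤s (2⌊j/2⌋≤j j))

nth-σ^ : ∀ k {j} → j < 2 ^ k → nth (σ^ k) j ≡ just (letter k j)
nth-σ^ zero    {zero}  _    = refl
nth-σ^ zero    {suc j} (s≤s ())
nth-σ^ (suc k) {j}     j<2^1+k rewrite nth-concatMap-σ (σ^ k) j | nth-σ^ k (⌊/2⌋-< j<2^1+k) = refl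

⌊2n/2⌋≡n : ∀ n → ⌊ 2 ℕ.* n /2⌋ ≡ n
⌊2n/2⌋≡n n = trans (cong (λ m → ⌊ n ℕ.+ m /2⌋) (ℕP.+-identityʳ n)) (sym (ℕP.n≡⌊n+n/2⌋ n))

⌊1+2n/2⌋≡n : ∀ n → ⌊ suc (2 ℕ.* n) /2⌋ ≡ n
⌊1+2n/2⌋≡n n = trans (cong (λ m → ⌊ suc (n ℕ.+ m) /2⌋) (ℕP.+-identityʳ n)) (sym (ℕP.n≡⌈n+n/2⌉ n))

parity-2n : ∀ n → parity (2 ℕ.* n) ≡ 0ℙ
parity-2n n = ℙP.*-homo-* 2 n

parity-1+2n : ∀ n → parity (suc (2 ℕ.* n)) ≡ 1ℙ
parity-1+2n n = trans (ℙP.+-homo-+ 1 (2 ℕ.* n)) (cong (1ℙ ℙ.+_) (parity-2n n))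

letter-even : ∀ k n → letter (suc k) (2 ℕ.* n) ≡ σ-at (letter k n) 0ℙ
letter-even k n rewrite ⌊2n/2⌋≡n n | parity-2n n = refl

letter-odd : ∀ k n → letter (suc k) (suc (2 ℕ.* n)) ≡ σ-at (letter k n) 1ℙ
letter-odd k n rewrite ⌊1+2n/2⌋≡n n | parity-1+2n n = refl

barParity-letter : ∀ k j → barParity (letter (suc k) j) ≡ parity j
barParity-letter k j = barParity-σ-at _ (parity j)

barParity-letter-even : ∀ k n → barParity (letter k (2 ℕ.* n)) ≡ 0ℙ
barParity-letter-even zero    n = refl
barParity-letter-even (suc k) n = trans (barParity-letter k (2 ℕ.* n)) (parity-2n n)

proj-letter-doubled : ∀ k v o → proj (letter (suc k) (2 ^ suc v ℕ.* o)) ≡ proj (letter k (2 ^ v ℕ.* o))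
proj-letter-doubled k v o rewrite ℕP.*-assoc 2 (2 ^ v) o | letter-even k (2 ^ v ℕ.* o) = proj-σ-at-0ℙ _

private
  1+4q≡1+2[2q] : ∀ q → 1 ℕ.* suc (4 ℕ.* q) ≡ suc (2 ℕ.* (2 ℕ.* q))
  1+4q≡1+2[2q] = ℕ-Solver.solve-∀

  3+4q≡1+2[1+2q] : ∀ q → 1 ℕ.* (3 ℕ.+ 4 ℕ.* q) ≡ suc (2 ℕ.* suc (2 ℕ.* q))
  3+4q≡1+2[1+2q] = ℕ-Solver.solve-∀

proj-letter-1+4q : ∀ v k q → proj (letter k (2 ^ v ℕ.* suc (4 ℕ.* q))) ≡ a
proj-letter-1+4q v       zero    q = refl
proj-letter-1+4q zero    (suc k) q = begin
  proj (letter (suc k) (1 ℕ.* suc (4 ℕ.* q)))    ≡⟨ cong (λ j → proj (letter (suc k) j)) (1+4q≡1+2[2q] q) ⟩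
  proj (letter (suc k) (suc (2 ℕ.* (2 ℕ.* q))))  ≡⟨ cong proj (letter-odd k (2 ℕ.* q)) ⟩
  proj (σ-at (letter k (2 ℕ.* q)) 1ℙ)            ≡⟨ proj-σ-at-1ℙ-unbarred _ (barParity-letter-even k q) ⟩
  a                                              ∎
  where open ≡-Reasoning
proj-letter-1+4q (suc v) (suc k) q = trans (proj-letter-doubled k v _) (proj-letter-1+4q v k q)

proj-letter-3+4q : ∀ v k q → 2 ^ v ℕ.* (3 ℕ.+ 4 ℕ.* q) < 2 ^ k → proj (letter k (2 ^ v ℕ.* (3 ℕ.+ 4 ℕ.* q))) ≡ b
proj-letter-3+4q v zero q 2^v[3+4q]<1 = ⊥-elim (ℕP.<⇒≱ 2^v[3+4q]<1 (ℕP.*-mono-≤ (ℕP.m^n>0 2 v) (s≤s z≤n)))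
proj-letter-3+4q zero (suc zero) q (s≤s (s≤s ()))
proj-letter-3+4q zero (suc (suc k)) q _ = begin
  proj (letter (2 ℕ.+ k) (1 ℕ.* (3 ℕ.+ 4 ℕ.* q)))       ≡⟨ cong (λ j → proj (letter (2 ℕ.+ k) j)) (3+4q≡1+2[1+2q] q) ⟩
  proj (letter (2 ℕ.+ k) (suc (2 ℕ.* suc (2 ℕ.* q))))   ≡⟨ cong proj (letter-odd (suc k) (suc (2 ℕ.* q))) ⟩
  proj (σ-at (letter (suc k) (suc (2 ℕ.* q))) 1ℙ)       ≡⟨ proj-σ-at-1ℙ-barred _ (trans (barParity-letter k _) (parity-1+2n q)) ⟩
  b                                                     ∎
  where open ≡-Reasoning
proj-letter-3+4q (suc v) (suc k) q bound =
  trans (proj-letter-doubled k v _)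
        (proj-letter-3+4q v k q (ℕP.*-cancelˡ-< 2 _ _ (subst (_< 2 ^ suc k) (ℕP.*-assoc 2 (2 ^ v) _) bound)))

-- Toeplitz words with a 2-adic phase

pow2-suc : ∀ e → pow2 (suc e) ≡ + 2 * pow2 e
pow2-suc e = ℤP.pos-* 2 (2 ^ e)

Class : ℤ → ℕ → ℤ → Set
Class r v x = x ≡ r * pow2 v [mod2^ 2 ℕ.+ v ]

Class-shift : ∀ {v x} r s d k → Class r v x → r + d ≡ s + k * + 4 → Class s v (x + d * pow2 v)
Class-shift {v} {x} r s d k x≡r eq = mod-trans (mod-+ʳ (d * pow2 v) x≡r) (witness k (begin
  r * pow2 v + d * pow2 v          ≡⟨ ℤP.*-distribʳ-+ (pow2 v) r d ⟨
  (r + d) * pow2 v                 ≡⟨ cong (_* pow2 v) eq ⟩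
  (s + k * + 4) * pow2 v           ≡⟨ [s+4k]p≡sp+k[4p] s k (pow2 v) ⟩
  s * pow2 v + k * (+ 4 * pow2 v)  ≡⟨ cong (λ p → s * pow2 v + k * p) (sym pow2-2+v) ⟩
  s * pow2 v + k * pow2 (2 ℕ.+ v)  ∎))
  where
    open ≡-Reasoning
    pow2-2+v : pow2 (2 ℕ.+ v) ≡ + 4 * pow2 v
    pow2-2+v = trans (pow2-suc (suc v)) (trans (cong (+ 2 *_) (pow2-suc v)) (sym (ℤP.*-assoc (+ 2) (+ 2) (pow2 v))))
    [s+4k]p≡sp+k[4p] : ∀ s k p → (s + k * + 4) * p ≡ s * p + k * (+ 4 * p)
    [s+4k]p≡sp+k[4p] = solve-∀

2^-mono-< : ∀ {m n} → m < n → 2 ^ m < 2 ^ n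
2^-mono-< = ℕP.^-monoʳ-< 2 (s≤s (s≤s z≤n))

valuation⇒Class₁⊎Class₃ : ∀ {x v} → HasValuation x v → Class (+ 1) v x ⊎ Class (+ 3) v x
valuation⇒Class₁⊎Class₃ {x} {v} x≡2^v with residue-split (2^-mono-< (ℕP.n<1+n v)) x≡2^v
... | inj₁ x≡1 = inj₁ (subst (x ≡_[mod2^ 2 ℕ.+ v ]) (sym (ℤP.*-identityˡ (pow2 v))) x≡1)
... | inj₂ x≡3 = inj₂ (subst (x ≡_[mod2^ 2 ℕ.+ v ]) (pos-3*2^v v) x≡3)
  where
    pos-3*2^v : ∀ v → + (2 ^ v ℕ.+ 2 ^ suc v) ≡ + 3 * pow2 v
    pos-3*2^v v = trans (cong +_ (p+2p≡3p (2 ^ v))) (ℤP.pos-* 3 (2 ^ v))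
      where p+2p≡3p : ∀ p → p ℕ.+ 2 ℕ.* p ≡ 3 ℕ.* p
            p+2p≡3p = ℕ-Solver.solve-∀

divisible⇒Class₀⊎Class₂ : ∀ {x v} → x ≡ + 0 [mod2^ suc v ] → Class (+ 0) v x ⊎ Class (+ 2) v x
divisible⇒Class₀⊎Class₂ {x} {v} x≡0 with residue-split (ℕP.m^n>0 2 (suc v)) x≡0
... | inj₁ x≡0′ = inj₁ (subst (x ≡_[mod2^ 2 ℕ.+ v ]) (sym (ℤP.*-zeroˡ (pow2 v))) x≡0′)
... | inj₂ x≡2 = inj₂ (subst (x ≡_[mod2^ 2 ℕ.+ v ]) (pow2-suc v) x≡2)

Class-shift-2^1+v : ∀ {v x} r s k → r + + 2 ≡ s + k * + 4 → Class r v x → Class s v (x + + 1 * pow2 (suc v))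
Class-shift-2^1+v {v} {x} r s k eq c = subst (λ d → Class s v (x + d)) 2*2^v≡2^1+v (Class-shift r s (+ 2) k c eq)
  where 2*2^v≡2^1+v : + 2 * pow2 v ≡ + 1 * pow2 (suc v)
        2*2^v≡2^1+v = trans (sym (pow2-suc v)) (sym (ℤP.*-identityˡ _))

Class-+0 : ∀ {v x} r → Class r v x → Class r v (x + + 0 * pow2 v)
Class-+0 {v} {x} r = subst (Class r v) (sym (trans (cong (λ d → x + d) (ℤP.*-zeroˡ (pow2 v))) (ℤP.+-identityʳ x)))

Coherent : (ℕ → ℕ) → Set
Coherent W = ∀ {e e′} → e ≤ e′ → + W e′ ≡ + W e [mod2^ e ]

phase : (ℕ → ℕ) → ℕ → ℤ → ℤ
phase W e i = + W e + i

phase-+ : ∀ W e i d → phase W e (i + d) ≡ phase W e i + d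
phase-+ W e i d = sym (ℤP.+-assoc (+ W e) i d)

ToeplitzPhase : (ℕ → ℕ) → (ℤ → AB) → Set
ToeplitzPhase W z = ∀ i v → (Class (+ 1) v (phase W (2 ℕ.+ v) i) → z i ≡ a)
                          × (Class (+ 3) v (phase W (2 ℕ.+ v) i) → z i ≡ b)

module _ {W : ℕ → ℕ} (coherent : Coherent W) where

  phase-mod : ∀ {e e₁} i → e ≤ e₁ → phase W e₁ i ≡ phase W e i [mod2^ e ]
  phase-mod i e≤e₁ = mod-+ʳ i (coherent e≤e₁)

  phase-relevel : ∀ {e e₁ e₂ c} i → e ≤ e₁ → e ≤ e₂ → phase W e₁ i ≡ c [mod2^ e ] → phase W e₂ i ≡ c [mod2^ e ]
  phase-relevel i e≤e₁ e≤e₂ h = mod-trans (phase-mod i e≤e₂) (mod-trans (mod-sym (phase-mod i e≤e₁)) h)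

  module _ {z : ℤ → AB} (toeplitz : ToeplitzPhase W z) where

    Class₁⇒a : ∀ {v i} d → Class (+ 1) v (phase W (2 ℕ.+ v) i + d) → z (i + d) ≡ a
    Class₁⇒a {v} {i} d c = proj₁ (toeplitz (i + d) v) (subst (Class (+ 1) v) (sym (phase-+ W _ i d)) c)

    Class₃⇒b : ∀ {v i} d → Class (+ 3) v (phase W (2 ℕ.+ v) i + d) → z (i + d) ≡ b
    Class₃⇒b {v} {i} d c = proj₂ (toeplitz (i + d) v) (subst (Class (+ 3) v) (sym (phase-+ W _ i d)) c)

    both-classes⇒aperiodic : ∀ {i m v} k₁ k₂ → Class (+ 1) v (phase W (2 ℕ.+ v) i + k₁ * pow2 m) →
                             Class (+ 3) v (phase W (2 ℕ.+ v) i + k₂ * pow2 m) → ¬ HasPeriod z i m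
    both-classes⇒aperiodic {i} {m} k₁ k₂ c₁ c₃ periodic
      with () ← trans (sym (Class₁⇒a {i = i} (k₁ * pow2 m) c₁))
                  (trans (periodic k₁) (trans (sym (periodic k₂)) (Class₃⇒b {i = i} (k₂ * pow2 m) c₃)))


    HasPeriod-mono : ∀ {i m m′} → m ≤ m′ → HasPeriod z i m → HasPeriod z i m′
    HasPeriod-mono {i} {m} {m′} m≤m′ periodic k = subst (λ d → z (i + d) ≡ z i) (begin
      k * pow2 (m′ ℕ.∸ m) * pow2 m      ≡⟨ ℤP.*-assoc k _ _ ⟩
      k * (pow2 (m′ ℕ.∸ m) * pow2 m)    ≡⟨ cong (k *_) (sym (pow2-+ (m′ ℕ.∸ m) m)) ⟩
      k * pow2 (m′ ℕ.∸ m ℕ.+ m)         ≡⟨ cong (λ e → k * pow2 e) (ℕP.m∸n+n≡m m≤m′) ⟩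
      k * pow2 m′                       ∎) (periodic (k * pow2 (m′ ℕ.∸ m)))
      where open ≡-Reasoning

    Class-periodic : ∀ {v} r i k → Class r v (phase W (2 ℕ.+ v) i) → Class r v (phase W (2 ℕ.+ v) (i + k * pow2 (2 ℕ.+ v)))
    Class-periodic {v} r i k c = subst (Class r v) (sym (phase-+ W _ i _)) (mod-trans (+-multiple _ k) c)

    valuation⇒period : ∀ {i v} → HasValuation (phase W (suc v) i) v → HasPeriod z i (2 ℕ.+ v)
    valuation⇒period {i} {v} val k
      with valuation⇒Class₁⊎Class₃ (phase-relevel i ℕP.≤-refl (ℕP.n≤1+n (suc v)) val)
    ... | inj₁ c₁ = trans (proj₁ (toeplitz _ v) (Class-periodic (+ 1) i k c₁)) (sym (proj₁ (toeplitz i v) c₁))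
    ... | inj₂ c₃ = trans (proj₂ (toeplitz _ v) (Class-periodic (+ 3) i k c₃)) (sym (proj₂ (toeplitz i v) c₃))

    valuation⇒no-period : ∀ {i v} → HasValuation (phase W (suc v) i) v → ¬ HasPeriod z i (suc v)
    valuation⇒no-period {i} {v} val
      with valuation⇒Class₁⊎Class₃ (phase-relevel i ℕP.≤-refl (ℕP.n≤1+n (suc v)) val)
    ... | inj₁ c₁ = both-classes⇒aperiodic {i} {suc v} (+ 0) (+ 1) (Class-+0 (+ 1) c₁)
                                                                (Class-shift-2^1+v (+ 1) (+ 3) (+ 0) refl c₁)
    ... | inj₂ c₃ = both-classes⇒aperiodic {i} {suc v} (+ 1) (+ 0) (Class-shift-2^1+v (+ 3) (+ 1) (+ 1) refl c₃)
                                                                (Class-+0 (+ 3) c₃)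

    valuation⇒Level : ∀ {i v} → HasValuation (phase W (suc v) i) v → Level z i (suc v)
    valuation⇒Level val = valuation⇒period val , λ m m<2+v periodic →
      valuation⇒no-period val (HasPeriod-mono (ℕP.≤-pred m<2+v) periodic)

    divisible⇒no-period : ∀ {i v} → phase W (suc v) i ≡ + 0 [mod2^ suc v ] → ¬ HasPeriod z i v
    divisible⇒no-period {i} {v} x≡0
      with divisible⇒Class₀⊎Class₂ (phase-relevel i ℕP.≤-refl (ℕP.n≤1+n (suc v)) x≡0)
    ... | inj₁ c₀ = both-classes⇒aperiodic {i} {v} (+ 1) (- + 1) (Class-shift (+ 0) (+ 1) (+ 1) (+ 0) c₀ refl)
                                                        (Class-shift (+ 0) (+ 3) (- + 1) (- + 1) c₀ refl)
    ... | inj₂ c₂ = both-classes⇒aperiodic {i} {v} (- + 1) (+ 1) (Class-shift (+ 2) (+ 1) (- + 1) (+ 0) c₂ refl)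
                                                        (Class-shift (+ 2) (+ 3) (+ 1) (+ 0) c₂ refl)

    Level⇒valuation : ∀ {i ℓ} → Level z i ℓ → ∃ λ w → ℓ ≡ suc w × HasValuation (phase W (suc w) i) w
    Level⇒valuation {i} {ℓ} (periodic , minimal) with divisible⊎valuation< (2 ℕ.+ ℓ) (phase W (2 ℕ.+ ℓ) i)
    ... | inj₁ x≡0 = ⊥-elim (divisible⇒no-period x≡0 periodic)
    ... | inj₂ (w , w<2+ℓ , val) with ℕP.<-cmp (suc w) ℓ | phase-relevel i w<2+ℓ ℕP.≤-refl val
    ...   | tri< 1+w<ℓ _ _ | val′ = ⊥-elim (minimal (2 ℕ.+ w) (s≤s 1+w<ℓ) (valuation⇒period val′))
    ...   | tri≈ _ 1+w≡ℓ _ | val′ = w , sym 1+w≡ℓ , val′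
    ...   | tri> _ _ ℓ<1+w | val′ = ⊥-elim (valuation⇒no-period val′ (HasPeriod-mono ℓ<1+w periodic))

2^v<2^2+v : ∀ v → 2 ^ v < 2 ^ (2 ℕ.+ v)
2^v<2^2+v v = 2^-mono-< (ℕP.m<n+m v {2} (s≤s z≤n))

3*2^v<2^2+v : ∀ v → 3 ℕ.* 2 ^ v < 2 ^ (2 ℕ.+ v)
3*2^v<2^2+v v = subst (3 ℕ.* 2 ^ v <_) (ℕP.*-assoc 2 2 (2 ^ v))
                  (ℕP.*-monoˡ-< (2 ^ v) {{2^-nonZero v}} {3} {4} (s≤s (s≤s (s≤s (s≤s z≤n)))))

Class₁⇒proj-letter : ∀ {v j} k → Class (+ 1) v (+ j) → proj (letter k j) ≡ a
Class₁⇒proj-letter {v} {j} k c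
  with ≡[mod2^]⇒∃quotient (subst (+ j ≡_[mod2^ 2 ℕ.+ v ]) (ℤP.*-identityˡ (pow2 v)) c) (2^v<2^2+v v)
... | q , refl = subst (λ p → proj (letter k p) ≡ a) (sym (p+q[4p]≡p[1+4q] (2 ^ v) q)) (proj-letter-1+4q v k q)
  where p+q[4p]≡p[1+4q] : ∀ p q → p ℕ.+ q ℕ.* (2 ℕ.* (2 ℕ.* p)) ≡ p ℕ.* suc (4 ℕ.* q)
        p+q[4p]≡p[1+4q] = ℕ-Solver.solve-∀

Class₃⇒proj-letter : ∀ {v j k} → Class (+ 3) v (+ j) → j < 2 ^ k → proj (letter k j) ≡ b
Class₃⇒proj-letter {v} {j} {k} c j<2^k
  with ≡[mod2^]⇒∃quotient (subst (+ j ≡_[mod2^ 2 ℕ.+ v ]) (sym (ℤP.pos-* 3 (2 ^ v))) c) (3*2^v<2^2+v v)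
... | q , refl = subst (λ p → p < 2 ^ k → proj (letter k p) ≡ b) (sym (3p+q[4p]≡p[3+4q] (2 ^ v) q)) (proj-letter-3+4q v k q) j<2^k
  where 3p+q[4p]≡p[3+4q] : ∀ p q → 3 ℕ.* p ℕ.+ q ℕ.* (2 ℕ.* (2 ℕ.* p)) ≡ p ℕ.* (3 ℕ.+ 4 ℕ.* q)
        3p+q[4p]≡p[3+4q] = ℕ-Solver.solve-∀

parity-mod2 : ∀ {j c} → + j ≡ + c [mod2^ 1 ] → c < 2 → parity j ≡ parity c
parity-mod2 {j} {c} j≡c c<2 with ≡[mod2^]⇒∃quotient j≡c c<2
... | q , refl = begin
  parity (c ℕ.+ q ℕ.* 2)           ≡⟨ ℙP.+-homo-+ c (q ℕ.* 2) ⟩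
  parity c ℙ.+ parity (q ℕ.* 2)    ≡⟨ cong (λ n → parity c ℙ.+ parity n) (ℕP.*-comm q 2) ⟩
  parity c ℙ.+ parity (2 ℕ.* q)    ≡⟨ cong (parity c ℙ.+_) (parity-2n q) ⟩
  parity c ℙ.+ 0ℙ                  ≡⟨ ℙP.+-identityʳ (parity c) ⟩
  parity c                         ∎
  where open ≡-Reasoning

window-appears : ∀ (y : ℤ → L4) i n J k → J ℕ.+ n ≤ 2 ^ k →
                 (∀ t → t < n → letter k (J ℕ.+ t) ≡ y (i + + t)) → AppearsInσω (window y i n)
window-appears y i n J k J+n≤2^k matches =
  k , take J (σ^ k) , drop (J ℕ.+ length w) (σ^ k) , infix-at (σ^ k) J w at-J
  where
    w = window y i n
    at-J : ∀ t → t < length w → nth (σ^ k) (J ℕ.+ t) ≡ nth w t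
    at-J t t<|w| = begin
      nth (σ^ k) (J ℕ.+ t)     ≡⟨ nth-σ^ k (ℕP.<-≤-trans (ℕP.+-monoʳ-< J t<n) J+n≤2^k) ⟩
      just (letter k (J ℕ.+ t)) ≡⟨ cong just (matches t t<n) ⟩
      just (y (i + + t))        ≡⟨ nth-window y i n t<n ⟨
      nth w t                   ∎
      where open ≡-Reasoning
            t<n = subst (t <_) (length-window y i n) t<|w|

-- Lifting a Toeplitz word to X_σ

n<2^n : ∀ n → n < 2 ^ n
n<2^n zero    = s≤s z≤n
n<2^n (suc n) = subst (_≤ 2 ^ suc n) (ℕP.+-comm (suc n) 1)
                  (ℕP.+-mono-≤ (n<2^n n) (ℕP.≤-trans (ℕP.m^n>0 2 n) (ℕP.m≤m+n (2 ^ n) 0)))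

module Lift {W : ℕ → ℕ} (coherent : Coherent W) {z : ℤ → AB} (toeplitz : ToeplitzPhase W z) where

  parity-of-phase : ℤ → Parity
  parity-of-phase i = parity (proj₁ (residue 1 (phase W 1 i)))

  lift : ℤ → L4
  lift i = toL4 (z i) (parity-of-phase i)

  proj-lift : ∀ i → z i ≡ proj (lift i)
  proj-lift i = sym (proj-toL4 (z i) _)

  letter≡lift : ∀ {d p j k} → 1 ≤ d → + p ≡ phase W d j [mod2^ d ] → proj (letter (suc k) p) ≡ z j →
                letter (suc k) p ≡ lift j
  letter≡lift {d} {p} {j} {k} 1≤d p≡phase proj≡z = L4-ext
    (trans proj≡z (proj-lift j))
    (trans (barParity-letter k p) (trans (parity-mod2 p≡c c<2) (sym (barParity-toL4 (z j) _))))
    where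
      c = proj₁ (residue 1 (phase W 1 j))
      c<2 = proj₁ (proj₂ (residue 1 (phase W 1 j)))
      p≡c : + p ≡ + c [mod2^ 1 ]
      p≡c = mod-trans (mod-weaken 1≤d p≡phase) (mod-trans (phase-mod coherent j 1≤d) (proj₂ (proj₂ (residue 1 (phase W 1 j)))))

  proj-letter≡z : ∀ {d p j k w} → 2 ℕ.+ w ≤ d → + p ≡ phase W d j [mod2^ d ] → HasValuation (+ p) w → p < 2 ^ k →
                  proj (letter k p) ≡ z j
  proj-letter≡z {d} {p} {j} {k} {w} 2+w≤d p≡phase val p<2^k =
    [ (λ c₁ → trans (Class₁⇒proj-letter k c₁) (sym (proj₁ (toeplitz j w) (phase≡ c₁)))) ,
      (λ c₃ → trans (Class₃⇒proj-letter {k = k} c₃ p<2^k) (sym (proj₂ (toeplitz j w) (phase≡ c₃)))) ]′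
    (valuation⇒Class₁⊎Class₃ val)
    where
      phase≡ : ∀ {c} → + p ≡ c [mod2^ 2 ℕ.+ w ] → phase W (2 ℕ.+ w) j ≡ c [mod2^ 2 ℕ.+ w ]
      phase≡ = mod-trans (phase-relevel coherent j 2+w≤d ℕP.≤-refl (mod-weaken 2+w≤d (mod-sym p≡phase)))

  -- The window is found in σ^k(a) at a start j₀ ≡ W + i (mod 2^d).  A position j₀ + t
  -- of 2-adic valuation below e then carries the letter of lift (i + t) automatically;
  -- since n < 2^e, at most one position t₀ of the window is divisible by 2^e, and j₀ is
  -- chosen so that j₀ + t₀ is an anchor carrying the required letter.
  module WindowAppears (i : ℤ) (n : ℕ) where
    e d k : ℕ
    e = 2 ℕ.+ n
    d = suc e
    k = 3 ℕ.+ d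

    c₀ : ℕ
    c₀ = proj₁ (residue d (phase W d i))

    c₀<2^d : c₀ < 2 ^ d
    c₀<2^d = proj₁ (proj₂ (residue d (phase W d i)))

    phase≡c₀ : phase W d i ≡ + c₀ [mod2^ d ]
    phase≡c₀ = proj₂ (proj₂ (residue d (phase W d i)))

    n<2^e : n < 2 ^ e
    n<2^e = ℕP.<-trans (ℕP.m<n+m n {2} (s≤s z≤n)) (n<2^n e)

    Start : ℕ → Set
    Start J = + J ≡ + c₀ [mod2^ d ] × J ℕ.+ n ≤ 2 ^ k ×
              (∀ t → t < n → (∃ λ w → w < e × HasValuation (+ (J ℕ.+ t)) w) ⊎ proj (letter k (J ℕ.+ t)) ≡ z (i + + t))

    Start⇒appears : ∀ {J} → Start J → AppearsInσω (window lift i n)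
    Start⇒appears {J} (J≡c₀ , J+n≤2^k , valuation-or-anchor) = window-appears lift i n J k J+n≤2^k matches
      where
        aligned : ∀ t → + (J ℕ.+ t) ≡ phase W d (i + + t) [mod2^ d ]
        aligned t = subst₂ (_≡_[mod2^ d ]) (sym (ℤP.pos-+ J t)) (sym (phase-+ W d i (+ t)))
                      (mod-trans (mod-+ʳ (+ t) J≡c₀) (mod-sym (mod-+ʳ (+ t) phase≡c₀)))
        matches : ∀ t → t < n → letter k (J ℕ.+ t) ≡ lift (i + + t)
        matches t t<n = letter≡lift {k = 2 ℕ.+ d} (s≤s z≤n) (aligned t) (proj≡ (valuation-or-anchor t t<n))
          where
            proj≡ : _ → proj (letter k (J ℕ.+ t)) ≡ z (i + + t)
            proj≡ (inj₁ (w , w<e , val)) =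
              proj-letter≡z {k = k} (s≤s w<e) (aligned t) val (ℕP.<-≤-trans (ℕP.+-monoʳ-< J t<n) J+n≤2^k)
            proj≡ (inj₂ anchored) = anchored

    2^d+2^d≤2^k : 2 ^ d ℕ.+ 2 ^ d ≤ 2 ^ k
    2^d+2^d≤2^k = subst (_≤ 2 ^ k) (cong (2 ^ d ℕ.+_) (ℕP.+-identityʳ (2 ^ d)))
                    (ℕP.^-monoʳ-≤ 2 {suc d} {k} (ℕP.m≤n+m (suc d) 2))

    n≤2^d : n ≤ 2 ^ d
    n≤2^d = ℕP.<⇒≤ (ℕP.<-≤-trans n<2^e (ℕP.^-monoʳ-≤ 2 (ℕP.n≤1+n e)))

    start-at-c₀ : ¬ (∃ λ t → t < n × (c₀ ℕ.+ t) %2^ e ≡ 0) → Start c₀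
    start-at-c₀ no-divisible = mod-refl , c₀+n≤2^k , λ t t<n → inj₁ (valuation t t<n)
      where
        c₀+n≤2^k = ℕP.≤-trans (ℕP.+-mono-≤ (ℕP.<⇒≤ c₀<2^d) n≤2^d) 2^d+2^d≤2^k
        valuation : ∀ t → t < n → ∃ λ w → w < e × HasValuation (+ (c₀ ℕ.+ t)) w
        valuation t t<n with divisible⊎valuation< e (+ (c₀ ℕ.+ t))
        ... | inj₁ divisible = ⊥-elim (no-divisible (t , t<n , ≡[mod2^]⇒%2^≡ divisible (ℕP.m^n>0 2 e)))
        ... | inj₂ v = v

    start-at-anchor : ∀ {t₀ p₀} → t₀ < n → + (c₀ ℕ.+ t₀) ≡ + 0 [mod2^ e ] → + p₀ ≡ + (c₀ ℕ.+ t₀) [mod2^ d ] →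
                      proj (letter k p₀) ≡ z (i + + t₀) → 2 ^ e ≤ p₀ → p₀ ≤ 3 ℕ.* 2 ^ d → Start (p₀ ℕ.∸ t₀)
    start-at-anchor {t₀} {p₀} t₀<n c₀+t₀≡0 p₀≡c₀+t₀ anchored 2^e≤p₀ p₀≤3*2^d =
      j₀≡c₀ , j₀+n≤2^k , valuation-or-anchor
      where
        j₀ = p₀ ℕ.∸ t₀
        j₀+t₀≡p₀ : j₀ ℕ.+ t₀ ≡ p₀
        j₀+t₀≡p₀ = ℕP.m∸n+n≡m (ℕP.≤-trans (ℕP.<⇒≤ (ℕP.<-trans t₀<n n<2^e)) 2^e≤p₀)
        j₀+t₀≡c₀+t₀ : + (j₀ ℕ.+ t₀) ≡ + (c₀ ℕ.+ t₀) [mod2^ d ]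
        j₀+t₀≡c₀+t₀ = subst (λ p → + p ≡ _ [mod2^ d ]) (sym j₀+t₀≡p₀) p₀≡c₀+t₀
        j₀≡c₀ : + j₀ ≡ + c₀ [mod2^ d ]
        j₀≡c₀ = mod-+-cancelʳ j₀ c₀ t₀ j₀+t₀≡c₀+t₀
        j₀+n≤2^k : j₀ ℕ.+ n ≤ 2 ^ k
        j₀+n≤2^k = ℕP.≤-trans (ℕP.+-mono-≤ (ℕP.≤-trans (ℕP.m∸n≤m p₀ t₀) p₀≤3*2^d) n≤2^d)
                    (subst (3 ℕ.* 2 ^ d ℕ.+ 2 ^ d ≤_) (3p+p+4p≡8p (2 ^ d)) (ℕP.m≤m+n _ _))
          where 3p+p+4p≡8p : ∀ p → (3 ℕ.* p ℕ.+ p) ℕ.+ 4 ℕ.* p ≡ 2 ℕ.* (2 ℕ.* (2 ℕ.* p))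
                3p+p+4p≡8p = ℕ-Solver.solve-∀
        valuation-or-anchor : ∀ t → t < n →
          (∃ λ w → w < e × HasValuation (+ (j₀ ℕ.+ t)) w) ⊎ proj (letter k (j₀ ℕ.+ t)) ≡ z (i + + t)
        valuation-or-anchor t t<n with t ℕ.≟ t₀
        ... | yes refl = inj₂ (subst (λ p → proj (letter k p) ≡ z (i + + t)) (sym j₀+t₀≡p₀) anchored)
        ... | no t≢t₀ with divisible⊎valuation< e (+ (j₀ ℕ.+ t))
        ...   | inj₂ v = inj₁ v
        ...   | inj₁ j₀+t≡0 = ⊥-elim (t≢t₀ (residue-unique (ℕP.<-trans t<n n<2^e) (ℕP.<-trans t₀<n n<2^e)
                  (mod-+-cancelˡ j₀ t t₀ (mod-trans j₀+t≡0
                    (mod-sym (mod-trans (mod-weaken (ℕP.n≤1+n e) j₀+t₀≡c₀+t₀) c₀+t₀≡0))))))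

    3*2^d<2^k : 3 ℕ.* 2 ^ d < 2 ^ k
    3*2^d<2^k = subst (3 ℕ.* 2 ^ d <_) (8p≡2[2[2p]] (2 ^ d))
                  (ℕP.*-monoˡ-< (2 ^ d) {{2^-nonZero d}} {3} {8} (s≤s (s≤s (s≤s (s≤s z≤n)))))
      where 8p≡2[2[2p]] : ∀ p → 8 ℕ.* p ≡ 2 ℕ.* (2 ℕ.* (2 ℕ.* p))
            8p≡2[2[2p]] = ℕ-Solver.solve-∀

    Anchor : ℕ → AB → Set
    Anchor x s = ∃ λ p → + p ≡ + x [mod2^ d ] × proj (letter k p) ≡ s × 2 ^ e ≤ p × p ≤ 3 ℕ.* 2 ^ d

    anchor-at : ∀ {x r} v → e ≤ v → v ≤ d → + (2 ^ v ℕ.* 1) ≡ + r [mod2^ d ] → + (2 ^ v ℕ.* 3) ≡ + r [mod2^ d ] →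
                + r ≡ + x [mod2^ d ] → ∀ s → Anchor x s
    anchor-at v e≤v v≤d 2^v≡r _ r≡x a =
      2 ^ v ℕ.* 1 , mod-trans 2^v≡r r≡x , proj-letter-1+4q v k 0 , lower 1 (s≤s z≤n) , upper 1 (s≤s z≤n)
      where
        lower : ∀ o → 1 ≤ o → 2 ^ e ≤ 2 ^ v ℕ.* o
        lower o 1≤o = ℕP.≤-trans (ℕP.^-monoʳ-≤ 2 e≤v)
                        (subst (_≤ 2 ^ v ℕ.* o) (ℕP.*-identityʳ (2 ^ v)) (ℕP.*-monoʳ-≤ (2 ^ v) 1≤o))
        upper : ∀ o → o ≤ 3 → 2 ^ v ℕ.* o ≤ 3 ℕ.* 2 ^ d
        upper o o≤3 = subst (2 ^ v ℕ.* o ≤_) (ℕP.*-comm (2 ^ d) 3) (ℕP.*-mono-≤ (ℕP.^-monoʳ-≤ 2 v≤d) o≤3)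
    anchor-at v e≤v v≤d _ 3*2^v≡r r≡x b =
      2 ^ v ℕ.* 3 , mod-trans 3*2^v≡r r≡x , proj-letter-3+4q v k 0 (ℕP.≤-<-trans upper 3*2^d<2^k) , lower , upper
      where
        lower : 2 ^ e ≤ 2 ^ v ℕ.* 3
        lower = ℕP.≤-trans (ℕP.^-monoʳ-≤ 2 e≤v) (ℕP.m≤m*n (2 ^ v) 3)
        upper : 2 ^ v ℕ.* 3 ≤ 3 ℕ.* 2 ^ d
        upper = subst (2 ^ v ℕ.* 3 ≤_) (ℕP.*-comm (2 ^ d) 3) (ℕP.*-monoˡ-≤ 3 (ℕP.^-monoʳ-≤ 2 v≤d))

    anchor : ∀ {x} s → + x ≡ + 0 [mod2^ e ] → Anchor x s
    anchor s x≡0 with residue-split (ℕP.m^n>0 2 e) x≡0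
    ... | inj₁ x≡0′  = anchor-at d (ℕP.n≤1+n e) ℕP.≤-refl (multiple-of-2^d 1) (multiple-of-2^d 3) (mod-sym x≡0′) s
      where multiple-of-2^d : ∀ o → + (2 ^ d ℕ.* o) ≡ + 0 [mod2^ d ]
            multiple-of-2^d o = witness (+ o) (trans (cong +_ (ℕP.*-comm (2 ^ d) o))
                                  (trans (ℤP.pos-* o (2 ^ d)) (sym (ℤP.+-identityˡ _))))
    ... | inj₂ x≡2^e = anchor-at e ℕP.≤-refl (ℕP.n≤1+n e) 2^e≡2^e 3*2^e≡2^e (mod-sym x≡2^e) s
      where
        2^e≡2^e : + (2 ^ e ℕ.* 1) ≡ + (2 ^ e) [mod2^ d ]
        2^e≡2^e = subst (λ p → + p ≡ + (2 ^ e) [mod2^ d ]) (sym (ℕP.*-identityʳ (2 ^ e))) mod-refl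
        3*2^e≡2^e : + (2 ^ e ℕ.* 3) ≡ + (2 ^ e) [mod2^ d ]
        3*2^e≡2^e = witness (+ 1) (trans (ℤP.pos-* (2 ^ e) 3)
                      (trans (3p≡p+2p (pow2 e)) (cong (λ p → pow2 e + + 1 * p) (sym (pow2-suc e)))))
          where 3p≡p+2p : ∀ p → p * + 3 ≡ p + + 1 * (+ 2 * p)
                3p≡p+2p = solve-∀

    appears : AppearsInσω (window lift i n)
    appears with anyUpTo? (λ t → (c₀ ℕ.+ t) %2^ e ℕ.≟ 0) n
    ... | no no-divisible = Start⇒appears (start-at-c₀ no-divisible)
    ... | yes (t₀ , t₀<n , divisible) =
      let c₀+t₀≡0 = %2^≡⇒≡[mod2^] divisible
          p₀ , p₀≡ , anchored , 2^e≤p₀ , p₀≤3*2^d = anchor (z (i + + t₀)) c₀+t₀≡0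
      in Start⇒appears (start-at-anchor t₀<n c₀+t₀≡0 p₀≡ anchored 2^e≤p₀ p₀≤3*2^d)

  lift-in-Xσ : Xσ lift
  lift-in-Xσ i n = WindowAppears.appears i n

  Toeplitz⇒XT : XT z
  Toeplitz⇒XT = lift , lift-in-Xσ , proj-lift

-- Runs as choice sequences

update : {A : Set} → ℤ → A → (ℤ → A) → ℤ → A
update h x f i with i ℤP.≟ h
... | yes _ = x
... | no  _ = f i

update-here : {A : Set} → ∀ h (x : A) f → update h x f h ≡ x
update-here h x f with h ℤP.≟ h
... | yes _   = refl
... | no  h≢h = ⊥-elim (h≢h refl)

update-there : {A : Set} → ∀ h (x : A) f {i} → i ≢ h → update h x f i ≡ f i
update-there h x f {i} i≢h with i ℤP.≟ h
... | yes i≡h = ⊥-elim (i≢h i≡h)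
... | no  _   = refl

module Choices {n m : ℕ} (M : NTM n m) where

  Option : Set
  Option = Fin n × Fin (suc m) × Move

  options : Config n m → List Option
  options c = NTM.δ M (state c) (tape c (head c))

  apply : Config n m → Option → Config n m
  apply c (q , γ , d) = record { state = q ; head = head c + moveBy d ; tape = update (head c) γ (tape c) }

  -- An out-of-range choice leaves the configuration unchanged; ValidFor excludes it.
  choose : Config n m → ℕ → Config n m
  choose c k with nth (options c) k
  ... | just o  = apply c o
  ... | nothing = c

  initial : Config n m
  initial = record { state = NTM.start M ; head = + 0 ; tape = λ _ → fzero }

  trace : (ℕ → ℕ) → ℕ → Config n m
  trace g zero    = initial
  trace g (suc t) = choose (trace g t) (g t)

  ValidFor : ℕ → (ℕ → ℕ) → Set
  ValidFor d g = ∀ {t} → t < d → Is-just (nth (options (trace g t)) (g t))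

  branching : ℕ
  branching = suc (max 0 (cartesianProductWith (λ q γ → length (NTM.δ M q γ)) (allFin n) (allFin (suc m))))

  length-options< : ∀ c → length (options c) < branching
  length-options< c = s≤s (All.lookup (xs≤max 0 _)
    (∈-cartesianProductWith⁺ (λ q γ → length (NTM.δ M q γ)) (∈-allFin (state c)) (∈-allFin (tape c (head c)))))

  step-apply : ∀ c o → o ∈ options c → Step M c (apply c o)
  step-apply c o@(q , γ , d) o∈ = o , o∈ , refl , refl , update-here (head c) γ (tape c) , λ i → update-there (head c) γ (tape c)

  step-choose : ∀ c k → Is-just (nth (options c) k) → Step M c (choose c k)
  step-choose c k is-just with nth (options c) k in eq
  ... | just o = step-apply c o (nth⇒∈ (options c) k eq)

  valid⇒Run : ∀ g → (∀ d → ValidFor d g) → Run M (trace g)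
  valid⇒Run g valid = (refl , refl , λ _ → refl) , λ t → step-choose (trace g t) (g t) (valid (suc t) ℕP.≤-refl)

  valid⇒bounded : ∀ {d g} → ValidFor d g → ∀ t → t < d → g t < branching
  valid⇒bounded {g = g} valid t t<d with nth (options (trace g t)) (g t) in eq | valid t<d
  ... | just o | _ = ℕP.<-trans (nth⇒< (options (trace g t)) (g t) eq) (length-options< (trace g t))

  trace-cong : ∀ {g g′} t → (∀ k → k < t → g k ≡ g′ k) → trace g t ≡ trace g′ t
  trace-cong zero    _    = refl
  trace-cong (suc t) g≡g′ = cong₂ choose (trace-cong t (λ k k<t → g≡g′ k (ℕP.m≤n⇒m≤1+n k<t))) (g≡g′ t ℕP.≤-refl)

  ValidFor-cong : ∀ {d g g′} → (∀ k → k < d → g k ≡ g′ k) → ValidFor d g → ValidFor d g′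
  ValidFor-cong {g = g} {g′} g≡g′ valid {t} t<d =
    subst Is-just (cong₂ (λ c k → nth (options c) k) (trace-cong t (λ k k<t → g≡g′ k (ℕP.<-trans k<t t<d))) (g≡g′ t t<d))
      (valid t<d)

  ValidFor-≤ : ∀ {d d′ g} → d ≤ d′ → ValidFor d′ g → ValidFor d g
  ValidFor-≤ d≤d′ valid t<d = valid (ℕP.<-≤-trans t<d d≤d′)

  _≈_ : Config n m → Config n m → Set
  c ≈ c′ = state c ≡ state c′ × head c ≡ head c′ × (∀ i → tape c i ≡ tape c′ i)

  options-≈ : ∀ {c c′} → c ≈ c′ → options c ≡ options c′
  options-≈ {c} {c′} (state≡ , head≡ , tape≡) = cong₂ (NTM.δ M) state≡ (trans (tape≡ (head c)) (cong (tape c′) head≡))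

  choose-just : ∀ c k {o} → nth (options c) k ≡ just o → choose c k ≡ apply c o
  choose-just c k eq with nth (options c) k
  choose-just c k refl | just o = refl

  module RunChoices {r : ℕ → Config n m} (run : Run M r) where

    taken : ℕ → Option
    taken t = proj₁ (proj₂ run t)

    choices : ℕ → ℕ
    choices t = proj₁ (∈⇒nth (proj₁ (proj₂ (proj₂ run t))))

    nth-choices : ∀ t → nth (options (r t)) (choices t) ≡ just (taken t)
    nth-choices t = proj₂ (∈⇒nth (proj₁ (proj₂ (proj₂ run t))))

    apply-≈ : ∀ t {c} → c ≈ r t → apply c (taken t) ≈ r (suc t)
    apply-≈ t {c} (state≡ , head≡ , tape≡) with proj₂ run t
    ... | (q , γ , d) , _ , state′≡ , head′≡ , written , unchanged =
      sym state′≡ , trans (cong (_+ moveBy d) head≡) (sym head′≡) , tape′≡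
      where
        tape′≡ : ∀ i → update (head c) γ (tape c) i ≡ tape (r (suc t)) i
        tape′≡ i with i ℤP.≟ head c
        ... | yes i≡h = trans (sym written) (cong (tape (r (suc t))) (sym (trans i≡h head≡)))
        ... | no  i≢h = trans (tape≡ i) (sym (unchanged i (λ i≡h′ → i≢h (trans i≡h′ (sym head≡)))))

    trace≈run : ∀ t → trace choices t ≈ r t
    trace≈run zero = let start≡ , head≡ , blank = proj₁ run in sym start≡ , sym head≡ , λ i → sym (blank i)
    trace≈run (suc t) = subst (_≈ r (suc t)) (sym (choose-just _ (choices t) nth≡)) (apply-≈ t (trace≈run t))
      where nth≡ = trans (cong (λ l → nth l (choices t)) (options-≈ (trace≈run t))) (nth-choices t)

    choices-valid : ∀ d → ValidFor d choices
    choices-valid d {t} _ rewrite options-≈ (trace≈run t) | nth-choices t = MaybeAny.just tt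

-- König's lemma

module König (lem : ExcludedMiddle 0ℓ) (B : ℕ) (P : List ℕ → Set) (prefix-closed : ∀ xs ys → P (xs ++ ys) → P xs) where

  Extends : List ℕ → ℕ → Set
  Extends xs d = ∃ λ ys → length ys ≡ d × All (_< B) ys × P (xs ++ ys)

  Unbounded : List ℕ → Set
  Unbounded xs = ∀ d → Extends xs d

  Extends-≤ : ∀ {xs d d′} → d ≤ d′ → Extends xs d′ → Extends xs d
  Extends-≤ {xs} {d} d≤d′ (ys , refl , ys<B , pxs++ys) =
    take d ys , trans (LP.length-take d ys) (ℕP.m≤n⇒m⊓n≡m d≤d′) , AllP.take⁺ d ys<B ,
    prefix-closed (xs ++ take d ys) (drop d ys) (subst P (split xs ys) pxs++ys)
    where split : ∀ xs ys → xs ++ ys ≡ (xs ++ take d ys) ++ drop d ys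
          split xs ys = trans (cong (xs ++_) (sym (LP.take++drop≡id d ys))) (sym (LP.++-assoc xs (take d ys) (drop d ys)))

  bounded⇒depth : ∀ {xs} → ¬ Unbounded xs → ∃ λ d → ¬ Extends xs d
  bounded⇒depth {xs} bounded = em⇒dne lem λ no-depth → bounded λ d → em⇒dne lem λ ¬ext → no-depth (d , ¬ext)

  unbounded-child-or-depth : ∀ xs k →
    (∃ λ c → c < k × Unbounded (xs ∷ʳ c)) ⊎ (∃ λ D → ∀ c → c < k → ¬ Extends (xs ∷ʳ c) D)
  unbounded-child-or-depth xs zero = inj₂ (0 , λ _ ())
  unbounded-child-or-depth xs (suc k) with unbounded-child-or-depth xs k | lem {Unbounded (xs ∷ʳ k)}
  ... | inj₁ (c , c<k , unbounded) | _ = inj₁ (c , ℕP.m≤n⇒m≤1+n c<k , unbounded)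
  ... | inj₂ _ | yes unbounded = inj₁ (k , ℕP.≤-refl , unbounded)
  ... | inj₂ (D , no-ext) | no bounded with bounded⇒depth bounded
  ...   | d , ¬ext = inj₂ (D ℕ.⊔ d , no-ext′)
    where
      no-ext′ : ∀ c → c < suc k → ¬ Extends (xs ∷ʳ c) (D ℕ.⊔ d)
      no-ext′ c c<1+k ext with ℕP.m≤n⇒m<n∨m≡n (ℕP.≤-pred c<1+k)
      ... | inj₁ c<k  = no-ext c c<k (Extends-≤ (ℕP.m≤m⊔n D d) ext)
      ... | inj₂ refl = ¬ext (Extends-≤ (ℕP.m≤n⊔m D d) ext)

  unbounded-child : ∀ {xs} → Unbounded xs → ∃ λ c → c < B × Unbounded (xs ∷ʳ c)
  unbounded-child {xs} unbounded with unbounded-child-or-depth xs B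
  ... | inj₁ child = child
  ... | inj₂ (D , no-ext) with unbounded (suc D)
  ...   | c ∷ ys , len , c<B ∷ ys<B , pxs++c∷ys =
    ⊥-elim (no-ext c c<B (ys , ℕP.suc-injective len , ys<B , subst P (sym (LP.++-assoc xs (c ∷ []) ys)) pxs++c∷ys))

  child : List ℕ → ℕ
  child xs with lem {∃ λ c → c < B × Unbounded (xs ∷ʳ c)}
  ... | yes (c , _) = c
  ... | no _        = 0

  child-unbounded : ∀ {xs} → Unbounded xs → child xs < B × Unbounded (xs ∷ʳ child xs)
  child-unbounded {xs} unbounded with lem {∃ λ c → c < B × Unbounded (xs ∷ʳ c)}
  ... | yes (_ , c<B , unbounded′) = c<B , unbounded′
  ... | no no-child = ⊥-elim (no-child (unbounded-child unbounded))

  path : ℕ → List ℕ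
  path zero    = []
  path (suc d) = path d ∷ʳ child (path d)

  branch : ℕ → ℕ
  branch d = child (path d)

  path≡applyUpTo : ∀ d → path d ≡ applyUpTo branch d
  path≡applyUpTo zero    = refl
  path≡applyUpTo (suc d) = trans (cong (_∷ʳ branch d) (path≡applyUpTo d)) (LP.applyUpTo-∷ʳ branch d)

  infinite-branch : Unbounded [] → ∃ λ g → (∀ d → g d < B) × (∀ d → P (applyUpTo g d))
  infinite-branch unbounded = branch , (λ d → proj₁ (child-unbounded (path-unbounded d))) , λ d →
    subst P (path≡applyUpTo d) (P-path d)
    where
      path-unbounded : ∀ d → Unbounded (path d)
      path-unbounded zero    = unbounded
      path-unbounded (suc d) = proj₂ (child-unbounded (path-unbounded d))
      P-path : ∀ d → P (path d)
      P-path d with path-unbounded d 0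
      ... | [] , _ , _ , p = subst P (LP.++-identityʳ (path d)) p

digit-divMod : ∀ Q .{{_ : ℕ.NonZero Q}} r k → r < Q → (r ℕ.+ k ℕ.* Q) % Q ≡ r × (r ℕ.+ k ℕ.* Q) / Q ≡ k
digit-divMod Q r k r<Q =
  trans ([m+kn]%n≡m%n r k Q) (m<n⇒m%n≡m r<Q) ,
  trans (+-distrib-/ r (k ℕ.* Q) (subst₂ (λ x y → x ℕ.+ y < Q) (sym (m<n⇒m%n≡m r<Q)) (sym (m*n%n≡0 k Q))
                                    (subst (_< Q) (sym (ℕP.+-identityʳ r)) r<Q)))
        (cong₂ ℕ._+_ (m<n⇒m/n≡0 r<Q) (m*n/n≡m k Q))

fromBits : List ℕ → ℕ
fromBits []       = 0
fromBits (x ∷ xs) = x % 2 ℕ.+ 2 ℕ.* fromBits xs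

fromBits-++ : ∀ xs ys → fromBits (xs ++ ys) ≡ fromBits xs ℕ.+ 2 ^ length xs ℕ.* fromBits ys
fromBits-++ []       ys = sym (ℕP.+-identityʳ (fromBits ys))
fromBits-++ (x ∷ xs) ys rewrite fromBits-++ xs ys = r+2[v+pw]≡r+2v+2pw (x % 2) (fromBits xs) (2 ^ length xs) (fromBits ys)
  where r+2[v+pw]≡r+2v+2pw : ∀ r v p w → r ℕ.+ 2 ℕ.* (v ℕ.+ p ℕ.* w) ≡ (r ℕ.+ 2 ℕ.* v) ℕ.+ 2 ℕ.* p ℕ.* w
        r+2[v+pw]≡r+2v+2pw = ℕ-Solver.solve-∀

fromBits-prefix : ∀ xs ys → + fromBits (xs ++ ys) ≡ + fromBits xs [mod2^ length xs ]
fromBits-prefix xs ys = witness (+ fromBits ys) (begin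
  + fromBits (xs ++ ys)                                  ≡⟨ cong +_ (fromBits-++ xs ys) ⟩
  + (fromBits xs ℕ.+ 2 ^ length xs ℕ.* fromBits ys)      ≡⟨ ℤP.pos-+ (fromBits xs) _ ⟩
  + fromBits xs + + (2 ^ length xs ℕ.* fromBits ys)      ≡⟨ cong (λ p → + fromBits xs + p) (ℤP.pos-* (2 ^ length xs) (fromBits ys)) ⟩
  + fromBits xs + pow2 (length xs) * + fromBits ys       ≡⟨ cong (λ p → + fromBits xs + p) (ℤP.*-comm (pow2 (length xs)) _) ⟩
  + fromBits xs + + fromBits ys * pow2 (length xs)       ∎)
  where open ≡-Reasoning

applyUpTo-+ : ∀ (f : ℕ → ℕ) d e → applyUpTo f (d ℕ.+ e) ≡ applyUpTo f d ++ applyUpTo (λ t → f (d ℕ.+ t)) e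
applyUpTo-+ f zero    e = refl
applyUpTo-+ f (suc d) e = cong (f 0 ∷_) (applyUpTo-+ (λ t → f (suc t)) d e)

fromBits-coherent : ∀ f → Coherent (λ d → fromBits (applyUpTo f d))
fromBits-coherent f {e} {e′} e≤e′ =
  subst₂ (λ l d → + fromBits l ≡ + fromBits (applyUpTo f e) [mod2^ d ])
    (sym (trans (cong (applyUpTo f) (sym (ℕP.m+[n∸m]≡n e≤e′))) (applyUpTo-+ f e (e′ ℕ.∸ e))))
    (LP.length-applyUpTo f e)
    (fromBits-prefix (applyUpTo f e) _)

-- A label x of a König tree stores one digit x % 2 of the phase and one choice x / 2
-- of the machine.
payload : List ℕ → ℕ → ℕ
payload xs t = fromMaybe 0 (nth xs t) / 2

digits : ℕ → ℕ → (ℕ → ℕ) → List ℕ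
digits zero    N h = []
digits (suc D) N h = (N % 2 ℕ.+ h 0 ℕ.* 2) ∷ digits D (N / 2) (λ t → h (suc t))

length-digits : ∀ D N h → length (digits D N h) ≡ D
length-digits zero    N h = refl
length-digits (suc D) N h = cong suc (length-digits D (N / 2) _)

payload-digits : ∀ D N h {t} → t < D → payload (digits D N h) t ≡ h t
payload-digits (suc D) N h {zero}  _        = proj₂ (digit-divMod 2 (N % 2) (h 0) (m%n<n N 2))
payload-digits (suc D) N h {suc t} (s≤s t<) = payload-digits D (N / 2) (λ x → h (suc x)) t<

digits-bounded : ∀ B D N h → (∀ t → t < D → h t < B) → All (_< B ℕ.* 2) (digits D N h)
digits-bounded B zero    N h h<B = []
digits-bounded B (suc D) N h h<B =
  ℕP.<-≤-trans (ℕP.+-monoˡ-< (h 0 ℕ.* 2) (m%n<n N 2)) (ℕP.*-monoˡ-≤ 2 (h<B 0 (s≤s z≤n))) ∷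
  digits-bounded B D (N / 2) (λ x → h (suc x)) (λ t t< → h<B (suc t) (s≤s t<))

fromBits-digits : ∀ D N h → + fromBits (digits D N h) ≡ + N [mod2^ D ]
fromBits-digits zero    N h = witness (- + N) (0≡n-n (+ N))
  where 0≡n-n : ∀ n → + 0 ≡ n + (- n) * + 1
        0≡n-n = solve-∀
fromBits-digits (suc D) N h with fromBits-digits D (N / 2) (λ t → h (suc t))
... | witness k eq = witness k (begin
  + ((r ℕ.+ h 0 ℕ.* 2) % 2 ℕ.+ 2 ℕ.* V)   ≡⟨ cong (λ x → + (x ℕ.+ 2 ℕ.* V)) (proj₁ (digit-divMod 2 r (h 0) (m%n<n N 2))) ⟩
  + (r ℕ.+ 2 ℕ.* V)                       ≡⟨ trans (ℤP.pos-+ r (2 ℕ.* V)) (cong (λ x → + r + x) (ℤP.pos-* 2 V)) ⟩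
  + r + + 2 * + V                          ≡⟨ cong (λ x → + r + + 2 * x) eq ⟩
  + r + + 2 * (+ q + k * pow2 D)           ≡⟨ r+2[q+kp]≡r+2q+k[2p] (+ r) (+ q) k (pow2 D) ⟩
  (+ r + + q * + 2) + k * (+ 2 * pow2 D)   ≡⟨ cong₂ (λ x y → x + k * y) r+2q≡N (sym (pow2-suc D)) ⟩
  + N + k * pow2 (suc D)                   ∎)
  where
    open ≡-Reasoning
    r = N % 2
    q = N / 2
    V = fromBits (digits D q (λ t → h (suc t)))
    r+2[q+kp]≡r+2q+k[2p] : ∀ r q k p → r + + 2 * (q + k * p) ≡ (r + q * + 2) + k * (+ 2 * p)
    r+2[q+kp]≡r+2q+k[2p] = solve-∀
    r+2q≡N : + r + + q * + 2 ≡ + N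
    r+2q≡N = trans (cong (λ x → + r + x) (sym (ℤP.pos-* q 2)))
               (trans (sym (ℤP.pos-+ r (q ℕ.* 2))) (cong +_ (sym (m≡m%n+[m/n]*n N 2))))

payload-++ : ∀ xs ys {t} → t < length xs → payload (xs ++ ys) t ≡ payload xs t
payload-++ xs ys t< = cong (λ x → fromMaybe 0 x / 2) (nth-++ˡ xs ys t<)

payload-applyUpTo : ∀ f d {t} → t < d → payload (applyUpTo f d) t ≡ f t / 2
payload-applyUpTo f d t< = cong (λ x → fromMaybe 0 x / 2) (nth-applyUpTo f d t<)

Centered : ℕ → ℤ → Set
Centered d i = ∃ λ t → t < suc (2 ℕ.* d) × - + d + + t ≡ i

Centered-grow : ∀ d e {i} → Centered d i → Centered (d ℕ.+ e) i
Centered-grow d e (t , s≤s t≤2d , eq) = t ℕ.+ e , s≤s t+e≤2[d+e] , trans shifted eq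
  where
    t+e≤2[d+e] : t ℕ.+ e ≤ 2 ℕ.* (d ℕ.+ e)
    t+e≤2[d+e] = subst (t ℕ.+ e ≤_) (sym (ℕP.*-distribˡ-+ 2 d e)) (ℕP.+-mono-≤ t≤2d (ℕP.m≤n*m e 2))
    shifted : - + (d ℕ.+ e) + + (t ℕ.+ e) ≡ - + d + + t
    shifted = trans (cong₂ (λ x y → - x + y) (ℤP.pos-+ d e) (ℤP.pos-+ t e)) (-[d+e]+[t+e]≡-d+t (+ d) (+ e) (+ t))
      where -[d+e]+[t+e]≡-d+t : ∀ d e t → - (d + e) + (t + e) ≡ - d + t
            -[d+e]+[t+e]≡-d+t = solve-∀

Centered-exists : ∀ i e → ∃ λ d → e ≤ d × Centered d i
Centered-exists (+ k) e =
  k ℕ.+ e , ℕP.m≤n+m e k , (k ℕ.+ e) ℕ.+ k , s≤s index≤ ,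
  trans (cong (λ x → - + (k ℕ.+ e) + x) (ℤP.pos-+ (k ℕ.+ e) k)) (-d+[d+k]≡k (+ (k ℕ.+ e)) (+ k))
  where
    index≤ : (k ℕ.+ e) ℕ.+ k ≤ 2 ℕ.* (k ℕ.+ e)
    index≤ = subst ((k ℕ.+ e) ℕ.+ k ≤_) (cong ((k ℕ.+ e) ℕ.+_) (sym (ℕP.+-identityʳ _)))
               (ℕP.+-monoʳ-≤ (k ℕ.+ e) (ℕP.m≤m+n k e))
    -d+[d+k]≡k : ∀ d k → - d + (d + k) ≡ k
    -d+[d+k]≡k = solve-∀
Centered-exists -[1+ k ] e = suc k ℕ.+ e , ℕP.m≤n+m e (suc k) , e , s≤s (ℕP.≤-trans (ℕP.m≤n+m e (suc k)) (ℕP.m≤m+n _ _)) ,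
  trans (cong (λ x → - x + + e) (ℤP.pos-+ (suc k) e)) (-[a+b]+b≡-a (+ suc k) (+ e))
  where -[a+b]+b≡-a : ∀ a b → - (a + b) + b ≡ - a
        -[a+b]+b≡-a = solve-∀

-- Forbidden words

module ListCode {A : Set} (Q : ℕ) .{{_ : NonZero Q}} (enc : A → ℕ) (dec : ℕ → A)
                (enc< : ∀ x → enc x < Q) (dec-enc : ∀ x → dec (enc x) ≡ x) where

  encode : List A → ℕ
  encode []      = 0
  encode (x ∷ w) = suc (enc x ℕ.+ encode w ℕ.* Q)

  decode : (fuel : ℕ) → ℕ → List A
  decode zero       _       = []
  decode (suc fuel) zero    = []
  decode (suc fuel) (suc k) = dec (k % Q) ∷ decode fuel (k / Q)

  length≤encode : ∀ w → length w ≤ encode w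
  length≤encode []      = z≤n
  length≤encode (x ∷ w) = s≤s (ℕP.≤-trans (length≤encode w) (ℕP.≤-trans (ℕP.m≤m*n (encode w) Q) (ℕP.m≤n+m _ _)))

  decode-encode′ : ∀ w fuel → length w ≤ fuel → decode fuel (encode w) ≡ w
  decode-encode′ []      zero       _ = refl
  decode-encode′ []      (suc fuel) _ = refl
  decode-encode′ (x ∷ w) (suc fuel) (s≤s |w|≤fuel) with digit-divMod Q (enc x) (encode w) (enc< x)
  ... | mod≡ , div≡ rewrite mod≡ | div≡ = cong₂ _∷_ (dec-enc x) (decode-encode′ w fuel |w|≤fuel)

  decode-encode : ∀ w → decode (encode w) (encode w) ≡ w
  decode-encode w = decode-encode′ w (encode w) (length≤encode w)

∃Vec? : ∀ {B} n {P : Vec (Fin B) n → Set} → (∀ v → Dec (P v)) → Dec (Σ (Vec (Fin B) n) P)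
∃Vec? zero P? with P? []
... | yes p  = yes ([] , p)
... | no ¬p = no λ { ([] , p) → ¬p p }
∃Vec? {B} (suc n) {P} P? with FinP.any? (λ x → ∃Vec? n (λ xs → P? (x ∷ xs)))
... | yes (x , xs , p) = yes (x ∷ xs , p)
... | no ¬p             = no λ { (x ∷ xs , p) → ¬p (x , xs , p) }

toFunction : ∀ {B n} → Vec (Fin B) n → ℕ → ℕ
toFunction []       _       = 0
toFunction (x ∷ xs) zero    = toℕ x
toFunction (x ∷ xs) (suc t) = toFunction xs t

toFunction-< : ∀ {B n} (xs : Vec (Fin (suc B)) n) t → toFunction xs t < suc B
toFunction-< []       t       = s≤s z≤n
toFunction-< (x ∷ xs) zero    = FinP.toℕ<n x
toFunction-< (x ∷ xs) (suc t) = toFunction-< xs t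

fromFunction : ∀ {B} n (g : ℕ → ℕ) → (∀ t → t < n → g t < B) → Vec (Fin B) n
fromFunction zero    g g< = []
fromFunction (suc n) g g< = fromℕ< (g< 0 (s≤s z≤n)) ∷ fromFunction n (λ t → g (suc t)) (λ t t< → g< (suc t) (s≤s t<))

toFunction-fromFunction : ∀ {B} n g (g< : ∀ t → t < n → g t < B) {t} → t < n → toFunction (fromFunction n g g<) t ≡ g t
toFunction-fromFunction (suc n) g g< {zero}  _        = FinP.toℕ-fromℕ< _
toFunction-fromFunction (suc n) g g< {suc t} (s≤s t<) =
  toFunction-fromFunction n (λ x → g (suc x)) (λ x x< → g< (suc x) (s≤s x<)) t<

_≟AB_ : (x y : AB) → Dec (x ≡ y)
a ≟AB a = yes refl
a ≟AB b = no λ ()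
b ≟AB a = no λ ()
b ≟AB b = yes refl

module Forbidden {n m : ℕ} (M : NTM n m) where
  open Choices M

  Letter : Set
  Letter = Fin n × AB

  Constraint : ℕ → (ℕ → ℕ) → ℕ → Letter → ℕ → Set
  Constraint d g u (q , s) v =
      (u %2^ suc v ≡ 2 ^ v → q ≡ state (trace g (suc v)))
    × (2 ℕ.+ v ≤ d → (u %2^ (2 ℕ.+ v) ≡ 2 ^ v → s ≡ a) × (u %2^ (2 ℕ.+ v) ≡ 3 ℕ.* 2 ^ v → s ≡ b))

  Fits : ℕ → (ℕ → ℕ) → ℕ → List Letter → Set
  Fits d g off w = ∀ {t} → t < length w → MaybeAll.All (λ p → ∀ {v} → v < d → Constraint d g (off ℕ.+ t) p v) (nth w t)

  -- off is the phase of the first position of w modulo 2^d, ch the first d choices of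
  -- the machine.
  Explained : ℕ → List Letter → Set
  Explained d w = ∃ λ off → off < 2 ^ d × Σ (Vec (Fin branching) d) λ ch →
                    ValidFor d (toFunction ch) × Fits d (toFunction ch) off w

  Good : List Letter → Set
  Good w = Explained (length w) w

  good? : ∀ w → Dec (Good w)
  good? w = anyUpTo? (λ off → ∃Vec? (length w) λ ch → valid? (toFunction ch) ×-dec fits? (toFunction ch) off) (2 ^ length w)
    where
      d = length w
      valid? : ∀ g → Dec (ValidFor d g)
      valid? g = allUpTo? (λ t → MaybeAny.dec (λ _ → yes tt) (nth (options (trace g t)) (g t))) d
      constraint? : ∀ g u p v → Dec (Constraint d g u p v)
      constraint? g u (q , s) v =
        ((u %2^ suc v ℕ.≟ 2 ^ v) →-dec (q Fin.≟ state (trace g (suc v))))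
        ×-dec ((2 ℕ.+ v ℕ.≤? d) →-dec (((u %2^ (2 ℕ.+ v) ℕ.≟ 2 ^ v) →-dec (s ≟AB a))
                                       ×-dec ((u %2^ (2 ℕ.+ v) ℕ.≟ 3 ℕ.* 2 ^ v) →-dec (s ≟AB b))))
      fits? : ∀ g off → Dec (Fits d g off w)
      fits? g off = allUpTo? (λ t → MaybeAll.dec (λ p → allUpTo? (constraint? g (off ℕ.+ t) p) d) (nth w t)) d

  private
    abCode : AB → ℕ
    abCode a = 0
    abCode b = 1

    abDecode : ℕ → AB
    abDecode zero    = a
    abDecode (suc _) = b

    stateDecode : ℕ → Fin n
    stateDecode k with k ℕ.<? n
    ... | yes k<n = fromℕ< k<n
    ... | no  _   = NTM.start M

    letterCode : Letter → ℕ
    letterCode (q , s) = abCode s ℕ.+ toℕ q ℕ.* 2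

    letterDecode : ℕ → Letter
    letterDecode k = stateDecode (k / 2) , abDecode (k % 2)

    abCode<2 : ∀ s → abCode s < 2
    abCode<2 a = s≤s z≤n
    abCode<2 b = s≤s (s≤s z≤n)

    letterCode< : ∀ p → letterCode p < 2 ℕ.+ n ℕ.* 2
    letterCode< (q , s) = ℕP.<-≤-trans (ℕP.+-monoˡ-< (toℕ q ℕ.* 2) (abCode<2 s))
                            (s≤s (s≤s (ℕP.*-monoˡ-≤ 2 (ℕP.<⇒≤ (FinP.toℕ<n q)))))

    letterDecode-letterCode : ∀ p → letterDecode (letterCode p) ≡ p
    letterDecode-letterCode (q , s) with digit-divMod 2 (abCode s) (toℕ q) (abCode<2 s)
    ... | mod≡ , div≡ rewrite mod≡ | div≡ = cong₂ _,_ (stateDecode-toℕ q) (abDecode-abCode s)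
      where
        stateDecode-toℕ : ∀ q → stateDecode (toℕ q) ≡ q
        stateDecode-toℕ q with toℕ q ℕ.<? n
        ... | yes q<n = FinP.fromℕ<-toℕ q q<n
        ... | no  q≮n = ⊥-elim (q≮n (FinP.toℕ<n q))
        abDecode-abCode : ∀ s → abDecode (abCode s) ≡ s
        abDecode-abCode a = refl
        abDecode-abCode b = refl

  open ListCode (2 ℕ.+ n ℕ.* 2) letterCode letterDecode letterCode< letterDecode-letterCode

  forbidden : ℕ → Maybe (List Letter)
  forbidden k with good? (decode k k)
  ... | yes _ = nothing
  ... | no  _ = just (decode k k)

  forbidden⇒¬Good : ∀ {k w} → forbidden k ≡ just w → ¬ Good w
  forbidden⇒¬Good {k} eq with good? (decode k k)
  forbidden⇒¬Good refl | no ¬good = ¬good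

  ¬Good⇒forbidden : ∀ w → ¬ Good w → forbidden (encode w) ≡ just w
  ¬Good⇒forbidden w = decoded (encode w) (decode-encode w)
    where
      decoded : ∀ k → decode k k ≡ w → ¬ Good w → forbidden k ≡ just w
      decoded k refl ¬good with good? (decode k k)
      ... | yes good = ⊥-elim (¬good good)
      ... | no  _    = refl

  AllWindowsGood : (ℤ → Letter) → Set
  AllWindowsGood c = ∀ i n → Good (window c i n)

  AllWindowsGood⇒Avoids : ∀ {c} → AllWindowsGood c → Avoids forbidden c
  AllWindowsGood⇒Avoids {c} good k w eq i occurs =
    forbidden⇒¬Good eq (subst Good occurs (good i (length w)))

  Avoids⇒AllWindowsGood : ∀ {c} → Avoids forbidden c → AllWindowsGood c
  Avoids⇒AllWindowsGood {c} avoids i n with good? (window c i n)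
  ... | yes good = good
  ... | no ¬good = ⊥-elim (avoids _ _ (¬Good⇒forbidden _ ¬good) i (cong (window c i) (length-window c i n)))

-- The two inclusions

ToeplitzOn : ℕ → ℕ → (ℤ → AB) → Set
ToeplitzOn d N z = ∀ {i} → Centered d i → ∀ v → 2 ℕ.+ v ≤ d →
                   (Class (+ 1) v (+ N + i) → z i ≡ a) × (Class (+ 3) v (+ N + i) → z i ≡ b)

Class-resp : ∀ r {v x y d} → 2 ℕ.+ v ≤ d → x ≡ y [mod2^ d ] → Class r v y → Class r v x
Class-resp r 2+v≤d x≡y = mod-trans (mod-weaken 2+v≤d x≡y)

ToeplitzOn-prefix : ∀ {d e N N′ z} → + N′ ≡ + N [mod2^ d ] → ToeplitzOn (d ℕ.+ e) N′ z → ToeplitzOn d N z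
ToeplitzOn-prefix {d} {e} {N} {N′} N′≡N toeplitz {i} centered v 2+v≤d =
  let rule-a , rule-b = toeplitz (Centered-grow d e centered) v (ℕP.≤-trans 2+v≤d (ℕP.m≤m+n d e))
  in (λ c → rule-a (Class-resp (+ 1) 2+v≤d (mod-+ʳ i N′≡N) c)) ,
     (λ c → rule-b (Class-resp (+ 3) 2+v≤d (mod-+ʳ i N′≡N) c))

ToeplitzOn⇒ToeplitzPhase : ∀ {W z} → Coherent W → (∀ d → ToeplitzOn d (W d) z) → ToeplitzPhase W z
ToeplitzOn⇒ToeplitzPhase {W} coherent toeplitz i v =
  let d , 2+v≤d , centered = Centered-exists i (2 ℕ.+ v)
      rule-a , rule-b = toeplitz d centered v 2+v≤d
      relevel : ∀ r → Class r v (phase W (2 ℕ.+ v) i) → Class r v (phase W d i)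
      relevel r = Class-resp r ℕP.≤-refl (phase-mod coherent i 2+v≤d)
  in (λ c → rule-a (relevel (+ 1) c)) , (λ c → rule-b (relevel (+ 3) c))

letter-at-occurrence : ∀ (y : ℤ → L4) {i n k} u v → σ^ k ≡ u ++ (window y i n ++ v) →
                       ∀ {t} → t < n → length u ℕ.+ t < 2 ^ k × letter k (length u ℕ.+ t) ≡ y (i + + t)
letter-at-occurrence y {i} {n} {k} u v σ^k≡ {t} t<n = bound , MaybeP.just-injective (trans (sym (nth-σ^ k bound)) nth≡)
  where
    w = window y i n
    nth≡ : nth (σ^ k) (length u ℕ.+ t) ≡ just (y (i + + t))
    nth≡ = begin
      nth (σ^ k) (length u ℕ.+ t)             ≡⟨ cong (λ l → nth l (length u ℕ.+ t)) σ^k≡ ⟩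
      nth (u ++ (w ++ v)) (length u ℕ.+ t)    ≡⟨ nth-++ʳ u (w ++ v) t ⟩
      nth (w ++ v) t                          ≡⟨ nth-++ˡ w v (subst (t <_) (sym (length-window y i n)) t<n) ⟩
      nth w t                                 ≡⟨ nth-window y i n t<n ⟩
      just (y (i + + t))                      ∎
      where open ≡-Reasoning
    bound : length u ℕ.+ t < 2 ^ k
    bound = subst (length u ℕ.+ t <_) (length-σ^ k) (nth⇒< (σ^ k) _ nth≡)

centered-offset : ∀ N D t → + (N ℕ.+ D) + (- + D + + t) ≡ + (N ℕ.+ t)
centered-offset N D t = trans (cong (_+ (- + D + + t)) (ℤP.pos-+ N D)) (trans (n+d+[-d+t]≡n+t (+ N) (+ D) (+ t)) (sym (ℤP.pos-+ N t)))
  where n+d+[-d+t]≡n+t : ∀ n d t → (n + d) + (- d + t) ≡ n + t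
        n+d+[-d+t]≡n+t = solve-∀

module FromXT (lem : ExcludedMiddle 0ℓ) {z : ℤ → AB} (z∈XT : XT z) where

  y : ℤ → L4
  y = proj₁ z∈XT

  y∈Xσ : Xσ y
  y∈Xσ = proj₁ (proj₂ z∈XT)

  z≡proj-y : ∀ i → z i ≡ proj (y i)
  z≡proj-y = proj₂ (proj₂ z∈XT)

  P : List ℕ → Set
  P xs = ToeplitzOn (length xs) (fromBits xs) z

  P-prefix-closed : ∀ xs ys → P (xs ++ ys) → P xs
  P-prefix-closed xs ys p =
    ToeplitzOn-prefix (fromBits-prefix xs ys) (subst (λ d → ToeplitzOn d (fromBits (xs ++ ys)) z) (LP.length-++ xs) p)

  open König lem 2 P P-prefix-closed

  unbounded : Unbounded []
  unbounded D with y∈Xσ (- + D) (suc (2 ℕ.* D))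
  ... | k , prefix , suffix , σ^k≡ =
    ys , length-digits D N (λ _ → 0) , digits-bounded 1 D N (λ _ → 0) (λ _ _ → s≤s z≤n) ,
    subst (λ d → ToeplitzOn d (fromBits ys) z) (sym (length-digits D N (λ _ → 0))) toeplitz
    where
      N = length prefix ℕ.+ D
      ys = digits D N (λ _ → 0)
      toeplitz : ToeplitzOn D (fromBits ys) z
      toeplitz {i} (t , t<1+2D , refl) v 2+v≤D =
        (λ c → letter-is a (Class₁⇒proj-letter k (position≡ (+ 1) c))) ,
        (λ c → letter-is b (Class₃⇒proj-letter {k = k} (position≡ (+ 3) c) (proj₁ occurrence)))
        where
          j = length prefix ℕ.+ t
          occurrence = letter-at-occurrence y {i = - + D} {k = k} prefix suffix σ^k≡ t<1+2D
          position≡ : ∀ r → Class r v (+ fromBits ys + i) → Class r v (+ j)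
          position≡ r = Class-resp r 2+v≤D (mod-sym (subst (+ fromBits ys + i ≡_[mod2^ D ])
                          (centered-offset (length prefix) D t) (mod-+ʳ i (fromBits-digits D N (λ _ → 0)))))
          letter-is : ∀ s → proj (letter k j) ≡ s → z i ≡ s
          letter-is s proj≡s = trans (z≡proj-y i) (trans (cong proj (sym (proj₂ occurrence))) proj≡s)

  bits : ℕ → ℕ
  bits = proj₁ (infinite-branch unbounded)

  W : ℕ → ℕ
  W d = fromBits (applyUpTo bits d)

  coherent : Coherent W
  coherent = fromBits-coherent bits

  toeplitz : ToeplitzPhase W z
  toeplitz = ToeplitzOn⇒ToeplitzPhase coherent λ d →
    subst (λ e → ToeplitzOn e (W d) z) (LP.length-applyUpTo bits d) (proj₂ (proj₂ (infinite-branch unbounded)) d)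

%2^≡2^v⇒Class₁ : ∀ {u v} → u %2^ (2 ℕ.+ v) ≡ 2 ^ v → Class (+ 1) v (+ u)
%2^≡2^v⇒Class₁ {u} {v} eq = subst (+ u ≡_[mod2^ 2 ℕ.+ v ]) (sym (ℤP.*-identityˡ (pow2 v))) (%2^≡⇒≡[mod2^] eq)

%2^≡3*2^v⇒Class₃ : ∀ {u v} → u %2^ (2 ℕ.+ v) ≡ 3 ℕ.* 2 ^ v → Class (+ 3) v (+ u)
%2^≡3*2^v⇒Class₃ {u} {v} eq = subst (+ u ≡_[mod2^ 2 ℕ.+ v ]) (ℤP.pos-* 3 (2 ^ v)) (%2^≡⇒≡[mod2^] eq)

Class₁⇒%2^≡2^v : ∀ {u v} → Class (+ 1) v (+ u) → u %2^ (2 ℕ.+ v) ≡ 2 ^ v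
Class₁⇒%2^≡2^v {u} {v} c = ≡[mod2^]⇒%2^≡ (subst (+ u ≡_[mod2^ 2 ℕ.+ v ]) (ℤP.*-identityˡ (pow2 v)) c) (2^v<2^2+v v)

Class₃⇒%2^≡3*2^v : ∀ {u v} → Class (+ 3) v (+ u) → u %2^ (2 ℕ.+ v) ≡ 3 ℕ.* 2 ^ v
Class₃⇒%2^≡3*2^v {u} {v} c = ≡[mod2^]⇒%2^≡ (subst (+ u ≡_[mod2^ 2 ℕ.+ v ]) (sym (ℤP.pos-* 3 (2 ^ v))) c) (3*2^v<2^2+v v)

module Inclusions {n m : ℕ} (M : NTM n m) where
  open Choices M
  open Forbidden M

  Toeplitzification⇒AllWindowsGood : ExcludedMiddle 0ℓ → ∀ {c} → Toeplitzification (S M) c → AllWindowsGood c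
  Toeplitzification⇒AllWindowsGood lem {c} (z∈XT , α , (r , run , states) , consistent) i d =
    off , off< , ch , valid , fits
    where
      open FromXT lem z∈XT using (W; coherent; toeplitz)
      open RunChoices run using (choices; trace≈run; choices-valid)
      w = window c i d
      off = proj₁ (residue (length w) (phase W (length w) i))
      off< = proj₁ (proj₂ (residue (length w) (phase W (length w) i)))
      ch = fromFunction (length w) choices (valid⇒bounded (choices-valid _))
      choices≡ : ∀ {t} → t < length w → choices t ≡ toFunction ch t
      choices≡ t< = sym (toFunction-fromFunction _ choices _ t<)
      valid : ValidFor (length w) (toFunction ch)
      valid = ValidFor-cong (λ t t< → choices≡ t<) (choices-valid _)
      window-phase : ∀ t {e} → e ≤ length w → phase W e (i + + t) ≡ + (off ℕ.+ t) [mod2^ e ]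
      window-phase t {e} e≤ = phase-relevel coherent {e₁ = length w} (i + + t) e≤ ℕP.≤-refl (mod-weaken e≤
        (subst₂ (_≡_[mod2^ length w ]) (sym (phase-+ W (length w) i (+ t))) (sym (ℤP.pos-+ off t))
          (mod-+ʳ (+ t) (proj₂ (proj₂ (residue (length w) (phase W (length w) i)))))))
      fits : Fits (length w) (toFunction ch) off w
      fits {t} t<|w| = subst (MaybeAll.All (λ p → ∀ {v} → v < length w → Constraint (length w) (toFunction ch) (off ℕ.+ t) p v))
                         (sym (nth-window c i d (subst (t <_) (length-window c i d) t<|w|))) (MaybeAll.just constraint)
        where
          constraint : ∀ {v} → v < length w → Constraint (length w) (toFunction ch) (off ℕ.+ t) (c (i + + t)) v
          constraint {v} v< = state≡ , letter≡
            where
              u = off ℕ.+ t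
              state≡ : u %2^ suc v ≡ 2 ^ v → proj₁ (c (i + + t)) ≡ state (trace (toFunction ch) (suc v))
              state≡ val = trans (consistent (i + + t) (suc v) (valuation⇒Level coherent toeplitz {i + + t} {v}
                                 (mod-trans (window-phase t v<) (%2^≡⇒≡[mod2^] val))))
                         (trans (sym (states (suc v))) (trans (sym (proj₁ (trace≈run (suc v))))
                           (cong state (trace-cong (suc v) (λ k k< → choices≡ (ℕP.<-≤-trans k< v<))))))
              letter≡ : 2 ℕ.+ v ≤ length w →
                        (u %2^ (2 ℕ.+ v) ≡ 2 ^ v → proj₂ (c (i + + t)) ≡ a) × (u %2^ (2 ℕ.+ v) ≡ 3 ℕ.* 2 ^ v → proj₂ (c (i + + t)) ≡ b)
              letter≡ 2+v≤ = (λ val → proj₁ (toeplitz (i + + t) v) (mod-trans (window-phase t 2+v≤) (%2^≡2^v⇒Class₁ val))) ,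
                             (λ val → proj₂ (toeplitz (i + + t) v) (mod-trans (window-phase t 2+v≤) (%2^≡3*2^v⇒Class₃ val)))

  StatesOn : ℕ → ℕ → (ℕ → ℕ) → (ℤ → Letter) → Set
  StatesOn d N g c = ∀ {i} → Centered d i → ∀ {v} → v < d → HasValuation (+ N + i) v →
                     proj₁ (c i) ≡ state (trace g (suc v))

  module FromAllWindowsGood (lem : ExcludedMiddle 0ℓ) {c : ℤ → Letter} (good : AllWindowsGood c) where

    z : ℤ → AB
    z i = proj₂ (c i)

    Consistent : ℕ → List ℕ → Set
    Consistent d xs = ValidFor d (payload xs) × ToeplitzOn d (fromBits xs) z × StatesOn d (fromBits xs) (payload xs) c

    Q : List ℕ → Set
    Q xs = Consistent (length xs) xs

    Q-prefix-closed : ∀ xs ys → Q (xs ++ ys) → Q xs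
    Q-prefix-closed xs ys q =
      ValidFor-cong payload≡ (ValidFor-≤ (ℕP.m≤m+n d e) valid) ,
      ToeplitzOn-prefix (fromBits-prefix xs ys) toeplitz ,
      λ {i} centered {v} v<d val → trans (states (Centered-grow d e centered) (ℕP.<-≤-trans v<d (ℕP.m≤m+n d e))
                                           (mod-trans (mod-+ʳ i (mod-weaken v<d (fromBits-prefix xs ys))) val))
                                      (cong state (trace-cong (suc v) (λ k k< → payload≡ k (ℕP.<-≤-trans k< v<d))))
      where
        d = length xs
        e = length ys
        payload≡ : ∀ t → t < d → payload (xs ++ ys) t ≡ payload xs t
        payload≡ t t< = payload-++ xs ys t<
        q′ : Consistent (d ℕ.+ e) (xs ++ ys)
        q′ = subst (λ l → Consistent l (xs ++ ys)) (LP.length-++ xs) q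
        valid = proj₁ q′
        toeplitz = proj₁ (proj₂ q′)
        states = proj₂ (proj₂ q′)

    open König lem (branching ℕ.* 2) Q Q-prefix-closed

    unbounded : Unbounded []
    unbounded D = ys , length-digits D N g , digits-bounded _ D N g (λ t _ → toFunction-< ch t) ,
                  subst (λ d → Consistent d ys) (sym (length-digits D N g)) (valid′ , toeplitz , states)
      where
        len = suc (2 ℕ.* D)
        w = window c (- + D) len
        good-w : Explained len w
        good-w = subst (λ l → Explained l w) (length-window c (- + D) len) (good (- + D) len)
        off = proj₁ good-w
        ch = proj₁ (proj₂ (proj₂ good-w))
        valid = proj₁ (proj₂ (proj₂ (proj₂ good-w)))
        fits = proj₂ (proj₂ (proj₂ (proj₂ good-w)))
        g = toFunction ch
        N = off ℕ.+ D
        ys = digits D N g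
        D≤len : D ≤ len
        D≤len = ℕP.≤-trans (ℕP.m≤m+n D (D ℕ.+ 0)) (ℕP.n≤1+n _)
        payload≡ : ∀ t → t < D → g t ≡ payload ys t
        payload≡ t t< = sym (payload-digits D N g t<)
        valid′ : ValidFor D (payload ys)
        valid′ = ValidFor-cong payload≡ (ValidFor-≤ D≤len valid)
        offset≡ : ∀ t → + fromBits ys + (- + D + + t) ≡ + (off ℕ.+ t) [mod2^ D ]
        offset≡ t = subst (+ fromBits ys + (- + D + + t) ≡_[mod2^ D ]) (centered-offset off D t)
                      (mod-+ʳ (- + D + + t) (fromBits-digits D N g))
        constraint : ∀ {t} → t < len → ∀ {v} → v < len → Constraint len g (off ℕ.+ t) (c (- + D + + t)) v
        constraint {t} t<len = MaybeAll.drop-just (subst (MaybeAll.All _) (nth-window c (- + D) len t<len)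
                                 (fits (subst (t <_) (sym (length-window c (- + D) len)) t<len)))
        toeplitz : ToeplitzOn D (fromBits ys) z
        toeplitz (t , t<len , refl) v 2+v≤D =
          (λ cl → proj₁ rule (Class₁⇒%2^≡2^v (Class-resp (+ 1) 2+v≤D (mod-sym (offset≡ t)) cl))) ,
          (λ cl → proj₂ rule (Class₃⇒%2^≡3*2^v (Class-resp (+ 3) 2+v≤D (mod-sym (offset≡ t)) cl)))
          where v<len = ℕP.<-≤-trans (ℕP.≤-trans (ℕP.n≤1+n _) 2+v≤D) D≤len
                rule = proj₂ (constraint t<len v<len) (ℕP.≤-trans 2+v≤D D≤len)
        states : StatesOn D (fromBits ys) (payload ys) c
        states (t , t<len , refl) {v} v<D val =
          trans (proj₁ (constraint t<len (ℕP.<-≤-trans v<D D≤len))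
                  (≡[mod2^]⇒%2^≡ (mod-trans (mod-weaken v<D (mod-sym (offset≡ t))) val) (2^-mono-< (ℕP.n<1+n v))))
                (cong state (trace-cong (suc v) (λ k k< → payload≡ k (ℕP.<-≤-trans k< v<D))))

    labels : ℕ → ℕ
    labels = proj₁ (infinite-branch unbounded)

    W : ℕ → ℕ
    W d = fromBits (applyUpTo labels d)

    choices : ℕ → ℕ
    choices t = labels t / 2

    consistent : ∀ d → Consistent d (applyUpTo labels d)
    consistent d = subst (λ l → Consistent l (applyUpTo labels d)) (LP.length-applyUpTo labels d)
                     (proj₂ (proj₂ (infinite-branch unbounded)) d)

    payload≡choices : ∀ d t → t < d → payload (applyUpTo labels d) t ≡ choices t
    payload≡choices d t t< = payload-applyUpTo labels d t<

    coherent : Coherent W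
    coherent = fromBits-coherent labels

    toeplitz : ToeplitzPhase W z
    toeplitz = ToeplitzOn⇒ToeplitzPhase coherent (λ d → proj₁ (proj₂ (consistent d)))

    Level⇒state : ∀ i ℓ → Level z i ℓ → proj₁ (c i) ≡ state (trace choices ℓ)
    Level⇒state i ℓ level =
      let w , ℓ≡1+w , val = Level⇒valuation {W} coherent {z} toeplitz level
          d , 1+w≤d , centered = Centered-exists i (suc w)
      in subst (λ ℓ′ → proj₁ (c i) ≡ state (trace choices ℓ′)) (sym ℓ≡1+w)
           (trans (proj₂ (proj₂ (consistent d)) centered 1+w≤d (phase-relevel coherent i ℕP.≤-refl 1+w≤d val))
                  (cong state (trace-cong (suc w) (λ k k< → payload≡choices d k (ℕP.<-≤-trans k< 1+w≤d)))))

    toeplitzification : Toeplitzification (S M) c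
    toeplitzification =
      Lift.Toeplitz⇒XT coherent toeplitz ,
      (λ t → state (trace choices t)) ,
      (trace choices , valid⇒Run choices (λ d → ValidFor-cong (payload≡choices d) (proj₁ (consistent d))) , λ _ → refl) ,
      Level⇒state

  AllWindowsGood⇒Toeplitzification : ExcludedMiddle 0ℓ → ∀ {c} → AllWindowsGood c → Toeplitzification (S M) c
  AllWindowsGood⇒Toeplitzification lem good = FromAllWindowsGood.toeplitzification lem good

lemma14 : ∀ {n m : ℕ} (M : NTM n m) → Effective (Toeplitzification (S M))
lemma14 M = forbidden , λ lem c → mk⇔
  (λ c∈T → AllWindowsGood⇒Avoids {c} (Toeplitzification⇒AllWindowsGood lem c∈T))
  (λ avoids → AllWindowsGood⇒Toeplitzification lem (Avoids⇒AllWindowsGood {c} avoids))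
  where open Forbidden M
        open Inclusions M
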